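{- Let $N\ge9$ and let $g$ be a matrix over $\mathbb{Z}_N$ with three or four rows and five columns that generates an admissible linear code $C$ which is non-degenerate and not a direct sum. If $C$ is thin, then ($N$ is even and) up to isomorphism $C$ can be generated by the two-row matrix $$\begin{pmatrix}N/2&N/2&0&0&0\\N/2&0&N/2&1&N-1\end{pmatrix}.$$
   Context: $\mathbb{Z}_N=\mathbb{Z}/N\mathbb{Z}$, with elements identified with the representatives $0,\dots,N-1$. A linear code of length $n$ over $\mathbb{Z}_N$ is a submodule of $\mathbb{Z}_N^n$; its elements are words; it is generated by a matrix if it is generated by the rows of the matrix. It is extended if all words have coordinate sum $0\bmod N$. Call a linear code over $\mathbb{Z}_N$ admissible if it is extended and the greatest common divisor of $N$ and all entries of all words is $1$. It is degenerate if some coordinate is zero in all words. An extended code is thin if it contains no word with all entries nonzero. Two codes over the same $\mathbb{Z}_N$ and of the same length are isomorphic if they coincide after a permutation of coordinates. Direct sum: for codes $C_1$ over $\mathbb{Z}_{N_1}$ and $C_2$ over $\mathbb{Z}_{N_2}$, of lengths $\ge1$, with $L=\operatorname{lcm}(N_1,N_2)$, $C_1\oplus C_2$ is the code over $\mathbb{Z}_L$ consisting of all concatenations $\frac{L}{N_1}c_1\,|\,\frac{L}{N_2}c_2$, $c_1\in C_1$, $c_2\in C_2$. A code is a direct sum if it is isomorphic to some $C_1\oplus C_2$. -}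

module Defs where

open import Level using (0ℓ) renaming (suc to lsuc)
open import Data.Fin using (Fin; toℕ)
open import Data.Fin.Permutation using (Permutation′; _⟨$⟩ʳ_)
open import Data.Fin.Properties using (toℕ-fromℕ<; toℕ-injective)
open import Data.Nat using (ℕ; _+_; _*_; _∸_; NonZero; ≢-nonZero; ≢-nonZero⁻¹)
open import Data.Nat.Divisibility using (_∣_; 0∣⇒≡0; n∣m*n; m∣m*n)
open import Data.Nat.DivMod
open import Data.Nat.LCM using (lcm; m∣lcm[m,n]; n∣lcm[m,n]; lcm-least)
open import Data.Nat.Properties
  using (*-distribˡ-+; *-assoc; *-comm; m*n≡0⇒m≡0∨n≡0)
open import Data.Product using (_×_; _,_; ∃-syntax; Σ-syntax)
open import Data.Sum using (_⊎_; inj₁; inj₂; [_,_]′)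
open import Data.Vec using (Vec; []; _∷_; _++_; lookup; map; replicate; sum; tabulate; zipWith)
open import Data.Vec.Properties using (zipWith-++; map-++; map-replicate)
open import Function.Bundles using (_⇔_)
open import Relation.Binary.PropositionalEquality
open import Relation.Nullary using (¬_)
open import Relation.Unary using (Pred; _∈_)

private variable
  m n N : ℕ

-- ℤ_N is represented by Fin N: the element k stands for the class of toℕ k.

infixl 6 _+ₘ_
infixl 7 _*ₘ_

0ₘ : .{{_ : NonZero N}} → Fin N
0ₘ {N} = 0 mod N

_+ₘ_ : .{{_ : NonZero N}} → Fin N → Fin N → Fin N
_+ₘ_ {N} a b = (toℕ a + toℕ b) mod N

_*ₘ_ : .{{_ : NonZero N}} → Fin N → Fin N → Fin N
_*ₘ_ {N} a b = (toℕ a * toℕ b) mod N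

Word : ℕ → ℕ → Set
Word N n = Vec (Fin N) n

0ᵂ : .{{_ : NonZero N}} → Word N n
0ᵂ = replicate _ 0ₘ

infixl 6 _+ᵂ_
infixr 7 _·ᵂ_

_+ᵂ_ : .{{_ : NonZero N}} → Word N n → Word N n → Word N n
_+ᵂ_ = zipWith _+ₘ_

_·ᵂ_ : .{{_ : NonZero N}} → Fin N → Word N n → Word N n
a ·ᵂ w = map (a *ₘ_) w

record Code (N n : ℕ) .{{_ : NonZero N}} : Set (lsuc 0ℓ) where
  field
    Words    : Pred (Word N n) 0ℓ
    0-closed : 0ᵂ ∈ Words
    +-closed : ∀ {v w} → v ∈ Words → w ∈ Words → v +ᵂ w ∈ Words
    ·-closed : ∀ a {w} → w ∈ Words → a ·ᵂ w ∈ Words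

open Code public

Matrix : ℕ → ℕ → ℕ → Set
Matrix N m n = Vec (Word N n) m

data Span {N m n} .{{_ : NonZero N}} (g : Matrix N m n) : Pred (Word N n) 0ℓ where
  zero-word : Span g 0ᵂ
  row       : ∀ i → Span g (lookup g i)
  add       : ∀ {v w} → Span g v → Span g w → Span g (v +ᵂ w)
  scale     : ∀ a {w} → Span g w → Span g (a ·ᵂ w)

⟨_⟩ : .{{_ : NonZero N}} → Matrix N m n → Code N n
⟨ g ⟩ = record
  { Words    = Span g
  ; 0-closed = zero-word
  ; +-closed = add
  ; ·-closed = scale
  }

Extended : .{{_ : NonZero N}} → Code N n → Set
Extended {N} C = ∀ {w} → w ∈ Words C → N ∣ sum (map toℕ w)

IsGCD : Pred ℕ 0ℓ → ℕ → Set
IsGCD S d = (∀ {k} → k ∈ S → d ∣ k) × (∀ {e} → (∀ {k} → k ∈ S → e ∣ k) → e ∣ d)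

Admissible : .{{_ : NonZero N}} → Code N n → Set
Admissible {N} C =
  Extended C ×
  IsGCD (λ k → k ≡ N ⊎ (∃[ w ] w ∈ Words C × ∃[ i ] k ≡ toℕ (lookup w i))) 1

Degenerate : .{{_ : NonZero N}} → Code N n → Set
Degenerate C = ∃[ i ] (∀ {w} → w ∈ Words C → lookup w i ≡ 0ₘ)

-- Intended for extended codes only.
Thin : .{{_ : NonZero N}} → Code N n → Set
Thin C = ¬ (∃[ w ] w ∈ Words C × (∀ i → lookup w i ≢ 0ₘ))

permute : Permutation′ n → Word N n → Word N n
permute π w = tabulate (λ i → lookup w (π ⟨$⟩ʳ i))

infix 4 _≅_

_≅_ : .{{_ : NonZero N}} → Code N n → Code N n → Set
_≅_ {n = n} C D = Σ[ π ∈ Permutation′ n ] (∀ w → w ∈ Words C ⇔ permute π w ∈ Words D)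

-- The map ℤ_N → ℤ_L, c ↦ (L/N) c; it is well defined on residue classes when N ∣ L.
inflate : ∀ L .{{_ : NonZero L}} .{{_ : NonZero N}} → Fin N → Fin L
inflate {N} L c = (L / N * toℕ c) mod L

instance
  lcm-nonZero : ∀ {m n} .{{_ : NonZero m}} .{{_ : NonZero n}} → NonZero (lcm m n)
  lcm-nonZero {m} {n} = ≢-nonZero λ eq →
    [ ≢-nonZero⁻¹ m , ≢-nonZero⁻¹ n ]′
      (m*n≡0⇒m≡0∨n≡0 m (0∣⇒≡0 (subst (_∣ m * n) eq (lcm-least {m} {n} (m∣m*n n) (n∣m*n m)))))

private
  module _ {L : ℕ} .{{_ : NonZero L}} where

    toℕ-mod : ∀ x → toℕ (x mod L) ≡ x % L
    toℕ-mod x = toℕ-fromℕ< (m%n<n x L)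

    mod-cong : ∀ {x y} → x % L ≡ y % L → x mod L ≡ y mod L
    mod-cong {x} {y} eq =
      toℕ-injective (trans (toℕ-mod x) (trans eq (sym (toℕ-mod y))))

  module _ {N L : ℕ} .{{_ : NonZero N}} .{{_ : NonZero L}} (N∣L : N ∣ L) where
    open ≡-Reasoning

    q = L / N

    q*N : q * N ≡ L
    q*N = m/n*n≡m N∣L

    absorb : ∀ x → (q * toℕ (x mod N)) % L ≡ (q * x) % L
    absorb x = begin
      (q * toℕ (x mod N)) % L               ≡⟨ cong (λ y → (q * y) % L) (toℕ-mod x) ⟩
      (q * (x % N)) % L                     ≡⟨ [m+kn]%n≡m%n (q * (x % N)) (x / N) L ⟨
      (q * (x % N) + x / N * L) % L         ≡⟨ cong (λ y → (q * (x % N) + y) % L) eq ⟩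
      (q * (x % N) + q * (x / N * N)) % L   ≡⟨ cong (_% L) (*-distribˡ-+ q (x % N) (x / N * N)) ⟨
      (q * (x % N + x / N * N)) % L         ≡⟨ cong (λ y → (q * y) % L) (m≡m%n+[m/n]*n x N) ⟨
      (q * x) % L                           ∎
      where
      eq : x / N * L ≡ q * (x / N * N)
      eq = begin
        x / N * L         ≡⟨ cong (x / N *_) q*N ⟨
        x / N * (q * N)   ≡⟨ *-assoc (x / N) q N ⟨
        x / N * q * N     ≡⟨ cong (_* N) (*-comm (x / N) q) ⟩
        q * (x / N) * N   ≡⟨ *-assoc q (x / N) N ⟩
        q * (x / N * N)   ∎

    inflate-0 : inflate {N} L 0ₘ ≡ 0ₘ
    inflate-0 = mod-cong (trans (absorb 0) (cong (_% L) (*-comm q 0)))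

    inflate-+ : ∀ (a b : Fin N) → inflate L (a +ₘ b) ≡ inflate L a +ₘ inflate L b
    inflate-+ a b = mod-cong (begin
      (q * toℕ (a +ₘ b)) % L
        ≡⟨ absorb (toℕ a + toℕ b) ⟩
      (q * (toℕ a + toℕ b)) % L
        ≡⟨ cong (_% L) (*-distribˡ-+ q (toℕ a) (toℕ b)) ⟩
      (q * toℕ a + q * toℕ b) % L
        ≡⟨ %-distribˡ-+ (q * toℕ a) (q * toℕ b) L ⟩
      ((q * toℕ a) % L + (q * toℕ b) % L) % L
        ≡⟨ cong₂ (λ x y → (x + y) % L) (toℕ-mod (q * toℕ a)) (toℕ-mod (q * toℕ b)) ⟨
      (toℕ (inflate L a) + toℕ (inflate L b)) % L ∎)

    inflate-* : ∀ (a : Fin L) (b : Fin N) → inflate L ((toℕ a mod N) *ₘ b) ≡ a *ₘ inflate L b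
    inflate-* a b = mod-cong (begin
      (q * toℕ ((toℕ a mod N) *ₘ b)) % L
        ≡⟨ absorb (toℕ (toℕ a mod N) * toℕ b) ⟩
      (q * (toℕ (toℕ a mod N) * toℕ b)) % L
        ≡⟨ cong (_% L) (*-assoc q (toℕ (toℕ a mod N)) (toℕ b)) ⟨
      (q * toℕ (toℕ a mod N) * toℕ b) % L
        ≡⟨ %-distribˡ-* (q * toℕ (toℕ a mod N)) (toℕ b) L ⟩
      ((q * toℕ (toℕ a mod N)) % L * (toℕ b % L)) % L
        ≡⟨ cong (λ x → (x * (toℕ b % L)) % L) (absorb (toℕ a)) ⟩
      ((q * toℕ a) % L * (toℕ b % L)) % L
        ≡⟨ %-distribˡ-* (q * toℕ a) (toℕ b) L ⟨
      (q * toℕ a * toℕ b) % L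
        ≡⟨ cong (λ x → (x * toℕ b) % L) (*-comm q (toℕ a)) ⟩
      (toℕ a * q * toℕ b) % L
        ≡⟨ cong (_% L) (*-assoc (toℕ a) q (toℕ b)) ⟩
      (toℕ a * (q * toℕ b)) % L
        ≡⟨ %-distribˡ-* (toℕ a) (q * toℕ b) L ⟩
      (toℕ a % L * ((q * toℕ b) % L)) % L
        ≡⟨ cong (λ x → (toℕ a % L * x) % L) (m%n%n≡m%n (q * toℕ b) L) ⟨
      (toℕ a % L * ((q * toℕ b) % L % L)) % L
        ≡⟨ %-distribˡ-* (toℕ a) ((q * toℕ b) % L) L ⟨
      (toℕ a * ((q * toℕ b) % L)) % L
        ≡⟨ cong (λ x → (toℕ a * x) % L) (toℕ-mod (q * toℕ b)) ⟨
      (toℕ a * toℕ (inflate L b)) % L ∎)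

    inflateᵂ-0 : map (inflate {N} L) (0ᵂ {n = n}) ≡ 0ᵂ
    inflateᵂ-0 {n} = trans (map-replicate (inflate {N} L) 0ₘ n) (cong (replicate n) inflate-0)

    inflateᵂ-+ : (v w : Word N n) →
                 map (inflate L) (v +ᵂ w) ≡ map (inflate L) v +ᵂ map (inflate L) w
    inflateᵂ-+ []      []      = refl
    inflateᵂ-+ (a ∷ v) (b ∷ w) = cong₂ _∷_ (inflate-+ a b) (inflateᵂ-+ v w)

    inflateᵂ-· : ∀ (a : Fin L) (w : Word N n) →
                 map (inflate L) ((toℕ a mod N) ·ᵂ w) ≡ a ·ᵂ map (inflate L) w
    inflateᵂ-· a []      = refl
    inflateᵂ-· a (b ∷ w) = cong₂ _∷_ (inflate-* a b) (inflateᵂ-· a w)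

  replicate-++ : ∀ {A : Set} m {n} (x : A) → replicate m x ++ replicate n x ≡ replicate (m + n) x
  replicate-++ ℕ.zero    x = refl
  replicate-++ (ℕ.suc m) x = cong (x ∷_) (replicate-++ m x)

infixr 5 _⊕_

_⊕_ : ∀ {N₁ N₂ n₁ n₂} .{{_ : NonZero N₁}} .{{_ : NonZero N₂}} →
      Code N₁ n₁ → Code N₂ n₂ → Code (lcm N₁ N₂) (n₁ + n₂)
_⊕_ {N₁} {N₂} {n₁} {n₂} C₁ C₂ = record
  { Words    = Concatenations
  ; 0-closed =
      0ᵂ , 0ᵂ , 0-closed C₁ , 0-closed C₂ ,
      sym (trans (cong₂ _++_ (inflateᵂ-0 d₁ {n₁}) (inflateᵂ-0 d₂ {n₂})) (replicate-++ n₁ 0ₘ))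
  ; +-closed = sum-closed
  ; ·-closed = scalar-closed
  }
  where
  L  = lcm N₁ N₂
  d₁ = m∣lcm[m,n] N₁ N₂
  d₂ = n∣lcm[m,n] N₁ N₂

  Concatenations : Pred (Word L (n₁ + n₂)) 0ℓ
  Concatenations w = ∃[ c₁ ] ∃[ c₂ ] c₁ ∈ Words C₁ × c₂ ∈ Words C₂ ×
                     w ≡ map (inflate L) c₁ ++ map (inflate L) c₂

  sum-closed : ∀ {v w} → v ∈ Concatenations → w ∈ Concatenations → v +ᵂ w ∈ Concatenations
  sum-closed (v₁ , v₂ , v₁∈ , v₂∈ , refl) (w₁ , w₂ , w₁∈ , w₂∈ , refl) =
    v₁ +ᵂ w₁ , v₂ +ᵂ w₂ , +-closed C₁ v₁∈ w₁∈ , +-closed C₂ v₂∈ w₂∈ ,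
    trans (zipWith-++ _+ₘ_ (map (inflate L) v₁) (map (inflate L) v₂) _ _)
          (sym (cong₂ _++_ (inflateᵂ-+ d₁ v₁ w₁) (inflateᵂ-+ d₂ v₂ w₂)))

  scalar-closed : ∀ a {w} → w ∈ Concatenations → a ·ᵂ w ∈ Concatenations
  scalar-closed a (w₁ , w₂ , w₁∈ , w₂∈ , refl) =
    (toℕ a mod N₁) ·ᵂ w₁ , (toℕ a mod N₂) ·ᵂ w₂ ,
    ·-closed C₁ (toℕ a mod N₁) w₁∈ , ·-closed C₂ (toℕ a mod N₂) w₂∈ ,
    trans (map-++ (a *ₘ_) (map (inflate L) w₁) (map (inflate L) w₂))
          (sym (cong₂ _++_ (inflateᵂ-· d₁ a w₁) (inflateᵂ-· d₂ a w₂)))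

-- The indices force the modulus and the length of a direct sum to be
-- lcm N₁ N₂ and n₁ + n₂.
data IsDirectSum : ∀ {N n} .{{_ : NonZero N}} → Code N n → Set (lsuc 0ℓ) where
  direct-sum : ∀ {N₁ N₂ n₁ n₂} .{{_ : NonZero N₁}} .{{_ : NonZero N₂}}
               .{{_ : NonZero n₁}} .{{_ : NonZero n₂}}
               {C : Code (lcm N₁ N₂) (n₁ + n₂)}
               (C₁ : Code N₁ n₁) (C₂ : Code N₂ n₂) →
               C ≅ C₁ ⊕ C₂ → IsDirectSum C

-- The entry N / 2 has its intended meaning only for even N.
thinMatrix : ∀ N .{{_ : NonZero N}} → Matrix N 2 5
thinMatrix N =
  (h ∷ h ∷ o ∷ o ∷ o ∷ []) ∷
  (h ∷ o ∷ h ∷ 1 mod N ∷ (N ∸ 1) mod N ∷ []) ∷ []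
  where
  h o : Fin N
  h = (N / 2) mod N
  o = 0ₘ

{-# OPTIONS --safe #-}

-- Call a set S of coordinates a cover if every word vanishes somewhere on S. Let S be
-- an irredundant cover, x a word vanishing somewhere on S, and y a word that vanishes
-- on S only at a coordinate where x does not. The words y + t x show that ℕ is covered by
-- the sets { t : y_j + t x_j = 0 } with j ∈ S and x_j ≠ 0, each of them empty or a residue
-- class modulo the order of x_j. Enumerating the coverings of ℕ by at most four
-- classes, and using that coordinates sum to zero, gives 8x = 0 or 6x = 0 if |S| ≥ 4.
-- A group is not a union of two proper subgroups, so N ∣ 8 or N ∣ 6. Hence for N ≥ 9
-- three coordinates cover; on them every word is 000, 0hh, h0h or hh0 with N = 2h,
-- and the other two coordinates add up to 0. Indecomposability provides a word
-- (h, 0, h, 1, -1) up to order, and modulo its multiples only (h, h, 0, 0, 0) is left.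

module Submission where

open import Defs
open import Data.Bool using (Bool; true; false; _∧_; _∨_; not; if_then_else_; T)
open import Data.Bool.Properties using (T-∧; T-∨; T-≡; T?)
open import Data.Empty using (⊥; ⊥-elim)
open import Data.Fin using (Fin; zero; suc; toℕ; fromℕ<; splitAt; punchIn; _↑ˡ_; _↑ʳ_)
open import Data.Fin.Patterns using (0F; 1F; 2F; 3F; 4F)
open import Data.Fin.Permutation
  using (Permutation′; _⟨$⟩ʳ_; _⟨$⟩ˡ_; inverseˡ; inverseʳ; transpose; _∘ₚ_)
import Data.Fin.Permutation.Components as PC
open import Data.Fin.Properties
  using (any?; all?; punchInᵢ≢i; toℕ-fromℕ<; toℕ<n; toℕ-injective)
  renaming (_≟_ to _≟ᶠ_)
open import Data.Integer using (ℤ; +_; -[1+_]; -_; -1ℤ; ≢-nonZero)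
  renaming (_+_ to _+ᶻ_; _*_ to _*ᶻ_; _-_ to _-ᶻ_; ∣_∣ to abs; NonZero to NonZeroᶻ)
open import Data.Integer.DivMod using (_%ℕ_; _/ℕ_; n%ℕd<d; a≡a%ℕn+[a/ℕn]*n)
open import Data.Integer.Divisibility.Signed renaming (_∣_ to _∣ᶻ_; _∣?_ to _∣ᶻ?_)
import Data.Integer.Properties as ℤ
open import Data.Integer.Tactic.RingSolver using (solve-∀)
open import Data.Maybe using (Maybe; just; nothing; maybe′)
open import Data.Nat
  using (ℕ; zero; suc; NonZero; _+_; _*_; _∸_; _≡ᵇ_; _≤ᵇ_; _≤_; _<_; z≤n; s≤s; ≢-nonZero⁻¹; >-nonZero⁻¹)
open import Data.Nat.Divisibility using (_∣_)
import Data.Nat.Divisibility as ℕ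
open import Data.Nat.DivMod using (_/_; _%_; _mod_)
import Data.Nat.DivMod as ℕ
open import Data.Nat.GCD
  using (gcd; gcd-greatest; c*gcd[m,n]≡gcd[cm,cn]; module Bézout; module GCD)
open import Data.Nat.LCM using (lcm; lcm-least; m∣lcm[m,n])
import Data.Nat.Properties as ℕ
open import Data.Product using (_×_; _,_; proj₁; proj₂; ∃-syntax; Σ-syntax)
open import Data.Sum using (_⊎_; inj₁; inj₂; [_,_]′)
open import Data.Unit using (tt)
import Data.Vec as Vec
open import Data.Vec using (Vec; []; _∷_; lookup; map; tabulate; _++_; _[_]≔_)
open import Data.Vec.Properties
  using (lookup∘tabulate; tabulate∘lookup; tabulate-cong; lookup∘update; lookup∘update′;
         lookup-map; lookup-zipWith; lookup-replicate; map-cong; map-id)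
open import Function using (_∘_)
open import Function.Bundles using (_⇔_; mk⇔; Equivalence)
open import Relation.Binary.PropositionalEquality
open import Relation.Nullary
  using (¬_; Dec; yes; no; contradiction; ¬?; _×-dec_; _→-dec_)
open import Relation.Nullary.Decidable
  using (map′; toWitness; fromWitness; isYes; decidable-stable; from-yes; from-no)
open import Relation.Unary using (_∈_)

open import Algebra.Properties.CommutativeMonoid.Sum ℤ.+-0-commutativeMonoid
  using (sum; sum-remove; sum-permute)

open Equivalence using (to; from)
open _∣ᶻ_ using (quotient; equality)

-- Coverings by residue classes

every : ∀ {n} → (Fin n → Bool) → Bool
every {zero}  f = true
every {suc n} f = f zero ∧ every (f ∘ suc)

some : ∀ {n} → (Fin n → Bool) → Bool
some {zero}  f = false
some {suc n} f = f zero ∨ some (f ∘ suc)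

everyVec : ∀ n → (Vec Bool n → Bool) → Bool
everyVec zero    f = f []
everyVec (suc n) f = everyVec n (f ∘ (true ∷_)) ∧ everyVec n (f ∘ (false ∷_))

every⁻ : ∀ {n} (f : Fin n → Bool) → T (every f) → ∀ i → T (f i)
every⁻ f p zero    = proj₁ (to T-∧ p)
every⁻ f p (suc i) = every⁻ (f ∘ suc) (proj₂ (to (T-∧ {f zero}) p)) i

some⁻ : ∀ {n} (f : Fin n → Bool) → T (some f) → ∃[ i ] T (f i)
some⁻ {suc n} f p with to (T-∨ {f zero}) p
... | inj₁ q = zero , q
... | inj₂ q with some⁻ (f ∘ suc) q
...   | i , r = suc i , r

some⁺ : ∀ {n} (f : Fin n → Bool) i → T (f i) → T (some f)
some⁺ f zero    p = from (T-∨ {f zero}) (inj₁ p)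
some⁺ f (suc i) p = from (T-∨ {f zero}) (inj₂ (some⁺ (f ∘ suc) i p))

everyVec⁻ : ∀ {n} (f : Vec Bool n → Bool) → T (everyVec n f) → ∀ v → T (f v)
everyVec⁻ f p []          = p
everyVec⁻ {suc n} f p (true  ∷ v) =
  everyVec⁻ (f ∘ (true ∷_)) (proj₁ (to (T-∧ {everyVec n (f ∘ (true ∷_))}) p)) v
everyVec⁻ {suc n} f p (false ∷ v) =
  everyVec⁻ (f ∘ (false ∷_)) (proj₂ (to (T-∧ {everyVec n (f ∘ (true ∷_))}) p)) v

if⁻ : ∀ b {x y} → T (if b then x else y) → (T b × T x) ⊎ (¬ T b × T y)
if⁻ true  p = inj₁ (tt , p)
if⁻ false p = inj₂ ((λ ()) , p)

∨⁻ʳ : ∀ {a b} → ¬ T a → T (a ∨ b) → T b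
∨⁻ʳ {true}  na _ = contradiction tt na
∨⁻ʳ {false} na p = p

T-not⁻ : ∀ {b} → T (not b) → ¬ T b
T-not⁻ {false} _ ()

T-not⁺ : ∀ {b} → ¬ T b → T (not b)
T-not⁺ {true}  nb = nb tt
T-not⁺ {false} _  = tt

-- A hit r together with a multiple m of the modulus; m = 0 carries no information.
ResidueClass : Set
ResidueClass = Maybe ℕ × ℕ

contains : ℕ → ResidueClass → Bool
contains t (nothing , m)     = false
contains t (just r , zero)   = t ≡ᵇ r
contains t (just r , suc m)  = ((t ∸ r) % suc m) ≡ᵇ 0

module _ {n} (Ann Hit : Fin n → ℕ → Set) where

  Known : Fin n → ResidueClass → Set
  Known j (nothing , m) = Ann j m
  Known j (just r , m)  = Hit j r × Ann j m

  Known⇒Ann : ∀ j c → Known j c → Ann j (proj₂ c)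
  Known⇒Ann j (nothing , m) k = k
  Known⇒Ann j (just r , m)  k = proj₂ k

  update-known : ∀ s j c → (∀ i → Known i (lookup s i)) → Known j c →
                 ∀ i → Known i (lookup (s [ j ]≔ c) i)
  update-known s j c ks k i with i ≟ᶠ j
  ... | yes refl = subst (Known i) (sym (lookup∘update i s c)) k
  ... | no i≢j   = subst (Known i) (sym (lookup∘update′ i≢j s c)) (ks i)

module _ {n} (accept : Vec ℕ n → Bool) (allowed : Fin n → Bool) where
  mutual
    search : (t fuel : ℕ) → Vec ResidueClass n → Bool
    search t zero       s = accept (map proj₂ s)
    search t (suc fuel) s =
      if some (λ j → contains t (lookup s j)) then search (suc t) fuel s
      else every (λ j → not (allowed j) ∨ place t fuel s j (lookup s j))

    place : (t fuel : ℕ) → Vec ResidueClass n → Fin n → ResidueClass → Bool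
    place t fuel s j (nothing , m) = search (suc t) fuel (s [ j ]≔ (just t , m))
    place t fuel s j (just r , m)  =
      (gcd m (t ∸ r) ≡ᵇ 1) ∨ search (suc t) fuel (s [ j ]≔ (just r , gcd m (t ∸ r)))

  module _ (Ann Hit : Fin n → ℕ → Set)
           (ann-gcd : ∀ j a b → Ann j a → Ann j b → Ann j (gcd a b))
           (hit-∸ : ∀ j r t → Hit j r → Hit j t → Ann j (t ∸ r))
           (¬ann-1 : ∀ j → T (allowed j) → ¬ Ann j 1)
           (cover : ∀ t → ∃[ j ] T (allowed j) × Hit j t)
           where

    Outcome : Set
    Outcome = ∃[ g ] T (accept g) × (∀ j → Ann j (lookup g j))

    mutual
      search-sound : ∀ t fuel s → (∀ j → Known Ann Hit j (lookup s j)) → T (search t fuel s) → Outcome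
      search-sound t zero s ks p =
        map proj₂ s , p , λ j → subst (Ann j) (sym (lookup-map j proj₂ s)) (Known⇒Ann Ann Hit j (lookup s j) (ks j))
      search-sound t (suc fuel) s ks p
        with if⁻ (some (λ j → contains t (lookup s j))) p | cover t
      ... | inj₁ (_ , q) | _           = search-sound (suc t) fuel s ks q
      ... | inj₂ (_ , q) | j , al , hit =
        place-sound t fuel s j (lookup s j) ks (ks j) al hit
          (∨⁻ʳ (λ na → T-not⁻ na al)
               (every⁻ (λ j → not (allowed j) ∨ place t fuel s j (lookup s j)) q j))

      place-sound : ∀ t fuel s j c → (∀ j → Known Ann Hit j (lookup s j)) → Known Ann Hit j c →
                    T (allowed j) → Hit j t → T (place t fuel s j c) → Outcome
      place-sound t fuel s j (nothing , m) ks k al hit p =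
        search-sound (suc t) fuel _ (update-known Ann Hit s j _ ks (hit , k)) p
      place-sound t fuel s j (just r , m) ks (hit′ , k) al hit p =
        search-sound (suc t) fuel _ (update-known Ann Hit s j _ ks (hit′ , ann))
          (∨⁻ʳ (λ q → ¬ann-1 j al (subst (Ann j) (ℕ.≡ᵇ⇒≡ _ 1 q) ann)) p)
        where
        ann : Ann j (gcd m (t ∸ r))
        ann = ann-gcd j m (t ∸ r) k (hit-∸ j r t hit′ hit)

initial : ∀ {n} → Vec Bool n → Vec ResidueClass n
initial = map (λ b → nothing , (if b then 1 else 0))

-- Four residue classes that cover 2⁴ consecutive integers cover all of them.
opaque
  sieve : ∀ {n} → (Vec ℕ n → Bool) → (Fin n → Bool) → Vec Bool n → Bool
  sieve accept S z =
    if some (λ j → S j ∧ lookup z j) then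
      (if some (λ j → S j ∧ not (lookup z j))
       then search accept (λ j → S j ∧ not (lookup z j)) 0 16 (initial z)
       else accept (map proj₂ (initial z)))
    else true

module _ (D : ℤ) where

  zeros : ∀ {n} → (Fin n → ℤ) → Vec Bool n
  zeros x = tabulate (λ j → isYes (D ∣ᶻ? x j))

  zeros⁻ : ∀ {n} (x : Fin n → ℤ) j → T (lookup (zeros x) j) → D ∣ᶻ x j
  zeros⁻ x j p = toWitness (subst T (lookup∘tabulate _ j) p)

  zeros⁺ : ∀ {n} (x : Fin n → ℤ) j → D ∣ᶻ x j → T (lookup (zeros x) j)
  zeros⁺ x j p = subst T (sym (lookup∘tabulate _ j)) (fromWitness p)

  annihilator : ∀ {n} (x : Fin n → ℤ) j → D ∣ᶻ + (if lookup (zeros x) j then 1 else 0) *ᶻ x j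
  annihilator x j with lookup (zeros x) j | zeros⁻ x j
  ... | true  | z = subst (D ∣ᶻ_) (sym (ℤ.*-identityˡ (x j))) (z tt)
  ... | false | _ = divides (+ 0) refl

  ∣-gcd* : ∀ {a b} x → D ∣ᶻ + a *ᶻ x → D ∣ᶻ + b *ᶻ x → D ∣ᶻ + gcd a b *ᶻ x
  ∣-gcd* {a} {b} x p q = ∣ᵤ⇒∣ (subst (abs D ℕ.∣_) eq
    (gcd-greatest (subst (abs D ℕ.∣_) (abs* a) (∣⇒∣ᵤ p)) (subst (abs D ℕ.∣_) (abs* b) (∣⇒∣ᵤ q))))
    where
    abs* : ∀ c → abs (+ c *ᶻ x) ≡ abs x * c
    abs* c = trans (ℤ.abs-* (+ c) x) (ℕ.*-comm c (abs x))
    eq : gcd (abs x * a) (abs x * b) ≡ abs (+ gcd a b *ᶻ x)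
    eq = trans (sym (c*gcd[m,n]≡gcd[cm,cn] (abs x) a b)) (sym (abs* (gcd a b)))

  ∣-∸* : ∀ {r t} y x → D ∣ᶻ y +ᶻ + r *ᶻ x → D ∣ᶻ y +ᶻ + t *ᶻ x → D ∣ᶻ + (t ∸ r) *ᶻ x
  ∣-∸* {r} {t} y x p q with ℕ.≤-total r t
  ... | inj₂ t≤r rewrite ℕ.m≤n⇒m∸n≡0 t≤r = divides (+ 0) refl
  ... | inj₁ r≤t = subst (D ∣ᶻ_) eq (∣m∣n⇒∣m-n q p)
    where
    rearrange : ∀ y x r t → (y +ᶻ t *ᶻ x) -ᶻ (y +ᶻ r *ᶻ x) ≡ (t -ᶻ r) *ᶻ x
    rearrange = solve-∀
    eq : (y +ᶻ + t *ᶻ x) -ᶻ (y +ᶻ + r *ᶻ x) ≡ + (t ∸ r) *ᶻ x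
    eq = trans (rearrange y x (+ r) (+ t))
               (cong (_*ᶻ x) (trans (ℤ.m-n≡m⊖n t r) (ℤ.⊖-≥ r≤t)))

  opaque
    unfolding sieve

    -- The t with D ∣ y j + t * x j form a residue class modulo the order of x j.
    sieve-sound : ∀ {n : ℕ} (accept : Vec ℕ n → Bool) (S : Fin n → Bool) (x : Fin n → ℤ) →
      (∃[ j ] T (S j) × D ∣ᶻ x j) →
      (∀ i → T (S i) → Σ[ y ∈ (Fin n → ℤ) ] (∀ j → T (S j) → j ≢ i → ¬ D ∣ᶻ y j) ×
                              (∀ t → ∃[ j ] T (S j) × D ∣ᶻ y j +ᶻ + t *ᶻ x j)) →
      T (sieve accept S (zeros x)) →
      ∃[ g ] T (accept g) × (∀ j → D ∣ᶻ + lookup g j *ᶻ x j)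
    sieve-sound {n} accept S x (i₀ , Si₀ , D∣xi₀) family p
      with if⁻ (some (λ j → S j ∧ lookup (zeros x) j)) p
    ... | inj₂ (none , _) =
      contradiction (some⁺ _ i₀ (from T-∧ (Si₀ , zeros⁺ x i₀ D∣xi₀))) none
    ... | inj₁ (_ , q) with if⁻ (some (λ j → S j ∧ not (lookup (zeros x) j))) q
    ...   | inj₂ (_ , r) = map proj₂ (initial (zeros x)) , r , λ j →
      subst (λ m → D ∣ᶻ + m *ᶻ x j)
        (sym (trans (lookup-map j proj₂ (initial (zeros x))) (cong proj₂ (lookup-map j _ (zeros x)))))
        (annihilator x j)
    ...   | inj₁ (nonzero , r) with some⁻ _ nonzero
    ...     | i , s with to (T-∧ {S i}) s
    ...       | Si , xi≢0 with family i Si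
    ...         | y , y≢0 , hits =
      search-sound accept allowed Ann Hit
        (λ j a b → ∣-gcd* {a} {b} (x j)) (λ j r t → ∣-∸* {r} {t} (y j) (x j))
        (λ j al d → T-not⁻ (proj₂ (to (T-∧ {S j}) al)) (zeros⁺ x j (subst (D ∣ᶻ_) (ℤ.*-identityˡ (x j)) d)))
        cover 0 16 (initial (zeros x)) start r
      where
      Ann Hit : Fin n → ℕ → Set
      Ann j m = D ∣ᶻ + m *ᶻ x j
      Hit j t = D ∣ᶻ y j +ᶻ + t *ᶻ x j

      allowed : Fin n → Bool
      allowed j = S j ∧ not (lookup (zeros x) j)

      cover : ∀ t → ∃[ j ] T (allowed j) × D ∣ᶻ y j +ᶻ + t *ᶻ x j
      cover t with hits t
      ... | j , Sj , hit = j , from T-∧ (Sj , T-not⁺ xj≢0) , hit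
        where
        xj≢0 : ¬ T (lookup (zeros x) j)
        xj≢0 z = y≢0 j Sj (λ { refl → T-not⁻ xi≢0 z })
                   (∣m+n∣n⇒∣m {m = y j} hit (∣n⇒∣m*n (+ t) (zeros⁻ x j z)))

      start : ∀ j → Known Ann Hit j (lookup (initial (zeros x)) j)
      start j = subst (Known Ann Hit j) (sym (lookup-map j _ (zeros x))) (annihilator x j)

-- Exponents of irredundantly covered codes

+abs : ∀ a → ∃[ s ] + abs a ≡ s *ᶻ a
+abs (+ n)      = + 1 , sym (ℤ.*-identityˡ (+ n))
+abs -[1+ n ] = -1ℤ , sym (ℤ.-1*i≡-i -[1+ n ])

opaque
  bézout : ∀ a b → ∃[ α ] ∃[ β ] (α *ᶻ a +ᶻ β *ᶻ b ∣ᶻ a) × (α *ᶻ a +ᶻ β *ᶻ b ∣ᶻ b)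
  bézout a b with Bézout.lemma (abs a) (abs b) | +abs a | +abs b
  ... | Bézout.result d g i | s , s-eq | t , t-eq with combination i
    where
    open ≡-Reasoning
    combination : Bézout.Identity d (abs a) (abs b) → ∃[ x ] ∃[ y ] + d ≡ x *ᶻ + abs a +ᶻ y *ᶻ + abs b
    combination (Bézout.+- x y eq) = + x , - + y , (begin
      + d                                    ≡⟨ cancel (+ d) (+ y *ᶻ + abs b) ⟩
      (+ d +ᶻ + y *ᶻ + abs b) -ᶻ + y *ᶻ + abs b  ≡⟨ cong (λ z → (+ d +ᶻ z) -ᶻ + y *ᶻ + abs b) (sym (ℤ.pos-* y (abs b))) ⟩
      + (d + y * abs b) -ᶻ + y *ᶻ + abs b    ≡⟨ cong (λ z → + z -ᶻ + y *ᶻ + abs b) eq ⟩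
      + (x * abs a) -ᶻ + y *ᶻ + abs b        ≡⟨ cong₂ _+ᶻ_ (ℤ.pos-* x (abs a)) (ℤ.neg-distribˡ-* (+ y) (+ abs b)) ⟩
      + x *ᶻ + abs a +ᶻ - + y *ᶻ + abs b     ∎)
      where
      cancel : ∀ u v → u ≡ (u +ᶻ v) -ᶻ v
      cancel = solve-∀
    combination (Bézout.-+ x y eq) = - + x , + y , (begin
      + d                                    ≡⟨ cancel (+ d) (+ x *ᶻ + abs a) ⟩
      - (+ x *ᶻ + abs a) +ᶻ (+ d +ᶻ + x *ᶻ + abs a)  ≡⟨ cong (λ z → - (+ x *ᶻ + abs a) +ᶻ (+ d +ᶻ z)) (sym (ℤ.pos-* x (abs a))) ⟩
      - (+ x *ᶻ + abs a) +ᶻ + (d + x * abs a)  ≡⟨ cong (λ z → - (+ x *ᶻ + abs a) +ᶻ + z) eq ⟩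
      - (+ x *ᶻ + abs a) +ᶻ + (y * abs b)    ≡⟨ cong₂ _+ᶻ_ (ℤ.neg-distribˡ-* (+ x) (+ abs a)) (ℤ.pos-* y (abs b)) ⟩
      - + x *ᶻ + abs a +ᶻ + y *ᶻ + abs b     ∎)
      where
      cancel : ∀ u v → u ≡ - v +ᶻ (u +ᶻ v)
      cancel = solve-∀
  ... | x , y , eq = x *ᶻ s , y *ᶻ t ,
    subst (_∣ᶻ a) d≡ (∣ᵤ⇒∣ (GCD.gcd∣m g)) , subst (_∣ᶻ b) d≡ (∣ᵤ⇒∣ (GCD.gcd∣n g))
    where
    d≡ : + d ≡ x *ᶻ s *ᶻ a +ᶻ y *ᶻ t *ᶻ b
    d≡ = trans eq (cong₂ _+ᶻ_ (trans (cong (x *ᶻ_) s-eq) (sym (ℤ.*-assoc x s a)))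
                              (trans (cong (y *ᶻ_) t-eq) (sym (ℤ.*-assoc y t b))))

∣-sum : ∀ {n} D (v : Fin n → ℤ) → (∀ j → D ∣ᶻ v j) → D ∣ᶻ sum v
∣-sum {zero}  D v p = divides (+ 0) refl
∣-sum {suc n} D v p = ∣m∣n⇒∣m+n (p zero) (∣-sum D (v ∘ suc) (p ∘ suc))

∣-last : ∀ {n} D (v : Fin n → ℤ) i → D ∣ᶻ sum v → (∀ j → j ≢ i → D ∣ᶻ v j) → ∀ j → D ∣ᶻ v j
∣-last {suc n} D v i D∣sum p j with j ≟ᶠ i
... | no j≢i   = p j j≢i
... | yes refl = ∣m+n∣n⇒∣m (subst (D ∣ᶻ_) (sum-remove v) D∣sum)
                   (∣-sum D _ (λ k → p (punchIn j k) (punchInᵢ≢i j k)))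

∣-*-∣ : ∀ {D m n} x → m ℕ.∣ n → D ∣ᶻ + m *ᶻ x → D ∣ᶻ + n *ᶻ x
∣-*-∣ {D} {m} x (ℕ.divides q refl) p =
  subst (D ∣ᶻ_) (trans (sym (ℤ.*-assoc (+ q) (+ m) x)) (cong (_*ᶻ x) (sym (ℤ.pos-* q m)))) (∣n⇒∣m*n (+ q) p)

allBut : ∀ {n} → (Fin (suc n) → Bool) → Bool
allBut {zero}  ok = true
allBut {suc n} ok = if ok zero then allBut (ok ∘ suc) else every (ok ∘ suc)

allBut⁻ : ∀ {n} (ok : Fin (suc n) → Bool) → T (allBut ok) → ∃[ i ] (∀ j → j ≢ i → T (ok j))
allBut⁻ {zero}  ok p = zero , λ { zero j≢i → contradiction refl j≢i }
allBut⁻ {suc n} ok p with if⁻ (ok zero) p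
... | inj₂ (_ , q) = zero , λ { zero j≢i → contradiction refl j≢i ; (suc j) _ → every⁻ (ok ∘ suc) q j }
... | inj₁ (ok₀ , q) with allBut⁻ (ok ∘ suc) q
...   | i , r = suc i , λ { zero _ → ok₀ ; (suc j) j≢i → r j (j≢i ∘ cong suc) }

count : ∀ {n} → (Fin n → Bool) → ℕ
count {zero}  f = 0
count {suc n} f = (if f zero then 1 else 0) + count (f ∘ suc)

count-mono : ∀ {n} {f g : Fin n → Bool} → (∀ j → T (f j) → T (g j)) → count f ≤ count g
count-mono {zero}  p = z≤n
count-mono {suc n} {f} {g} p = ℕ.+-mono-≤ (head (f zero) (g zero) (p zero)) (count-mono (p ∘ suc))
  where
  head : ∀ a b → (T a → T b) → (if a then 1 else 0) ≤ (if b then 1 else 0)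
  head false b     _ = z≤n
  head true  true  _ = ℕ.≤-refl
  head true  false q = contradiction (q tt) (λ ())

killed : ∀ {n} → ℕ → Vec ℕ n → Fin n → Bool
killed k g j with lookup g j
... | zero  = false
... | suc m = k % suc m ≡ᵇ 0

killed⁻ : ∀ {n} k (g : Vec ℕ n) j → T (killed k g j) → lookup g j ℕ.∣ k
killed⁻ k g j p with lookup g j
... | suc m = ℕ.m%n≡0⇒n∣m k (suc m) (ℕ.≡ᵇ⇒≡ _ 0 p)

-- In the third case of accept₁ the word 2x vanishes in three coordinates, and it is
-- sieved again with accept₂.
accept₁ accept₂ : Vec ℕ 5 → Bool
accept₁ g = allBut (killed 8 g) ∨ allBut (killed 6 g) ∨ (3 ≤ᵇ count (killed 2 g))
accept₂ g = allBut (killed 2 g)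

opaque
  exponent-check : (Fin 5 → Bool) → Vec Bool 5 → Bool
  exponent-check S z = sieve accept₁ S z ∧ (not (3 ≤ᵇ count (lookup z)) ∨ sieve accept₂ S z)

  exponent-check⁻ : ∀ S z → T (exponent-check S z) →
                    T (sieve accept₁ S z) × (T (3 ≤ᵇ count (lookup z)) → T (sieve accept₂ S z))
  exponent-check⁻ S z p with to (T-∧ {sieve accept₁ S z}) p
  ... | p₁ , p₂ = p₁ , λ many → ∨⁻ʳ (λ few → T-not⁻ few many) p₂

off : Fin 5 → Fin 5 → Fin 5 → Bool
off l m j = not (isYes (j ≟ᶠ l)) ∧ not (isYes (j ≟ᶠ m))

Certified : (Fin 5 → Bool) → Set
Certified S = ∀ z → T (exponent-check S z)

certify : ∀ S → everyVec 5 (exponent-check S) ≡ true → Certified S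
certify S p = everyVec⁻ (exponent-check S) (from T-≡ p)

opaque
  unfolding sieve exponent-check

  certified-five : Certified (λ _ → true)
  certified-five = certify (λ _ → true) refl

  certified-four : ∀ l → Certified (off l l)
  certified-four 0F = certify (off 0F 0F) refl
  certified-four 1F = certify (off 1F 1F) refl
  certified-four 2F = certify (off 2F 2F) refl
  certified-four 3F = certify (off 3F 3F) refl
  certified-four 4F = certify (off 4F 4F) refl

module Exponent (D : ℤ) {L : (Fin 5 → ℤ) → Set}
         (L-+ : ∀ {u v} → L u → L v → L (λ j → u j +ᶻ v j))
         (L-* : ∀ k {v} → L v → L (λ j → k *ᶻ v j))
         (L-sum : ∀ {v} → L v → D ∣ᶻ sum v)
         where

  Covers Spread : (Fin 5 → Bool) → Set
  Covers S = ∀ {v} → L v → ∃[ j ] T (S j) × D ∣ᶻ v j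
  Spread S = ∀ i → T (S i) → ∃[ y ] L y × (∀ j → T (S j) → j ≢ i → ¬ D ∣ᶻ y j)

  sieve-lattice : ∀ {S} → Covers S → Spread S → ∀ accept {x} → L x → T (sieve accept S (zeros D x)) →
                  ∃[ g ] T (accept g) × (∀ j → D ∣ᶻ + lookup g j *ᶻ x j)
  sieve-lattice {S} covers spread accept {x} x∈L = sieve-sound D accept S x (covers x∈L) family
    where
    family : ∀ i → T (S i) → Σ[ y ∈ (Fin 5 → ℤ) ] (∀ j → T (S j) → j ≢ i → ¬ D ∣ᶻ y j) ×
                                                (∀ t → ∃[ j ] T (S j) × D ∣ᶻ y j +ᶻ + t *ᶻ x j)
    family i Si with spread i Si
    ... | y , y∈L , y≢0 = y , y≢0 , λ t → covers (L-+ y∈L (L-* (+ t) x∈L))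

  all-killed : ∀ k {x} g → L x → (∀ j → D ∣ᶻ + lookup g j *ᶻ x j) → T (allBut (killed k g)) →
               ∀ j → D ∣ᶻ + k *ᶻ x j
  all-killed k {x} g x∈L D∣gx p with allBut⁻ (killed k g) p
  ... | i , q = ∣-last D (λ j → + k *ᶻ x j) i (L-sum (L-* (+ k) x∈L)) λ j j≢i →
    ∣-*-∣ (x j) (killed⁻ k g j (q j j≢i)) (D∣gx j)

  exponent-8-or-6 : ∀ {S} → Certified S → Covers S → Spread S → ∀ {x} → L x →
                    (∀ j → D ∣ᶻ + 8 *ᶻ x j) ⊎ (∀ j → D ∣ᶻ + 6 *ᶻ x j)
  exponent-8-or-6 {S} check covers spread {x} x∈L
    with sieve-lattice covers spread accept₁ x∈L
           (proj₁ (exponent-check⁻ S (zeros D x) (check (zeros D x))))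
  ... | g , p , D∣gx with to (T-∨ {allBut (killed 8 g)}) p
  ...   | inj₁ q = inj₁ (all-killed 8 g x∈L D∣gx q)
  ...   | inj₂ p′ with to (T-∨ {allBut (killed 6 g)}) p′
  ...     | inj₁ q = inj₂ (all-killed 6 g x∈L D∣gx q)
  ...     | inj₂ q = inj₁ (λ j → ∣-*-∣ {m = 4} {n = 8} (x j) (ℕ.divides 2 refl)
                            (subst (D ∣ᶻ_) (sym (ℤ.*-assoc (+ 2) (+ 2) (x j))) (4x j)))
    where
    x₂ : Fin 5 → ℤ
    x₂ j = + 2 *ᶻ x j

    x₂∈L : L x₂
    x₂∈L = L-* (+ 2) x∈L

    many-zeros : T (3 ≤ᵇ count (lookup (zeros D x₂)))
    many-zeros = ℕ.≤⇒≤ᵇ (ℕ.≤-trans (ℕ.≤ᵇ⇒≤ 3 _ q) (count-mono λ j k →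
      zeros⁺ D x₂ j (∣-*-∣ (x j) (killed⁻ 2 g j k) (D∣gx j))))

    4x : ∀ j → D ∣ᶻ + 2 *ᶻ x₂ j
    4x with sieve-lattice covers spread accept₂ x₂∈L
              (proj₂ (exponent-check⁻ S (zeros D x₂) (check (zeros D x₂))) many-zeros)
    ... | h , r , D∣hx₂ = all-killed 2 h x₂∈L D∣hx₂ r

-- Words as integer vectors modulo N

infix 4 _≡_[mod_]

record _≡_[mod_] (a b D : ℤ) : Set where
  constructor mod-intro
  field difference : D ∣ᶻ a -ᶻ b

module _ {D : ℤ} where
  ≡-mod-refl : ∀ {a} → a ≡ a [mod D ]
  ≡-mod-refl {a} = mod-intro (divides (+ 0) (ℤ.+-inverseʳ a))

  ≡-mod-reflexive : ∀ {a b} → a ≡ b → a ≡ b [mod D ]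
  ≡-mod-reflexive refl = ≡-mod-refl

  ≡-mod-sym : ∀ {a b} → a ≡ b [mod D ] → b ≡ a [mod D ]
  ≡-mod-sym {a} {b} (mod-intro p) = mod-intro (subst (D ∣ᶻ_) (flip a b) (∣m⇒∣-m p))
    where
    flip : ∀ a b → - (a -ᶻ b) ≡ b -ᶻ a
    flip = solve-∀

  ≡-mod-trans : ∀ {a b c} → a ≡ b [mod D ] → b ≡ c [mod D ] → a ≡ c [mod D ]
  ≡-mod-trans {a} {b} {c} (mod-intro p) (mod-intro q) =
    mod-intro (subst (D ∣ᶻ_) (telescope a b c) (∣m∣n⇒∣m+n p q))
    where
    telescope : ∀ a b c → (a -ᶻ b) +ᶻ (b -ᶻ c) ≡ a -ᶻ c
    telescope = solve-∀

  ≡-mod-+ : ∀ {a b c d} → a ≡ b [mod D ] → c ≡ d [mod D ] → a +ᶻ c ≡ b +ᶻ d [mod D ]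
  ≡-mod-+ {a} {b} {c} {d} (mod-intro p) (mod-intro q) =
    mod-intro (subst (D ∣ᶻ_) (swap a b c d) (∣m∣n⇒∣m+n p q))
    where
    swap : ∀ a b c d → (a -ᶻ b) +ᶻ (c -ᶻ d) ≡ (a +ᶻ c) -ᶻ (b +ᶻ d)
    swap = solve-∀

  ≡-mod-* : ∀ {a b c d} → a ≡ b [mod D ] → c ≡ d [mod D ] → a *ᶻ c ≡ b *ᶻ d [mod D ]
  ≡-mod-* {a} {b} {c} {d} (mod-intro p) (mod-intro q) =
    mod-intro (subst (D ∣ᶻ_) (split a b c d) (∣m∣n⇒∣m+n (∣m⇒∣m*n c p) (∣n⇒∣m*n b q)))
    where
    split : ∀ a b c d → (a -ᶻ b) *ᶻ c +ᶻ b *ᶻ (c -ᶻ d) ≡ a *ᶻ c -ᶻ b *ᶻ d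
    split = solve-∀

  ∣⇒≡0-mod : ∀ {a} → D ∣ᶻ a → a ≡ + 0 [mod D ]
  ∣⇒≡0-mod {a} p = mod-intro (subst (D ∣ᶻ_) (sym (ℤ.+-identityʳ a)) p)

  ∣-resp-≡-mod : ∀ {a b} → a ≡ b [mod D ] → D ∣ᶻ b → D ∣ᶻ a
  ∣-resp-≡-mod {a} {b} (mod-intro p) q = subst (D ∣ᶻ_) (cancel a b) (∣m∣n⇒∣m+n p q)
    where
    cancel : ∀ a b → (a -ᶻ b) +ᶻ b ≡ a
    cancel = solve-∀

module _ {N : ℕ} .{{_ : NonZero N}} where

  mod-≡ : ∀ x → + toℕ (x mod N) ≡ + x [mod + N ]
  mod-≡ x = ≡-mod-sym (mod-intro (divides (+ (x ℕ./ N)) (begin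
    + x -ᶻ + toℕ (x mod N)                      ≡⟨ cong (λ r → + x -ᶻ + r) (toℕ-fromℕ< (ℕ.m%n<n x N)) ⟩
    + x -ᶻ + (x ℕ.% N)                          ≡⟨ cong (λ y → + y -ᶻ + (x ℕ.% N)) (ℕ.m≡m%n+[m/n]*n x N) ⟩
    + (x ℕ.% N + x ℕ./ N * N) -ᶻ + (x ℕ.% N)    ≡⟨ cancel (+ (x ℕ.% N)) (+ (x ℕ./ N * N)) ⟩
    + (x ℕ./ N * N)                             ≡⟨ ℤ.pos-* (x ℕ./ N) N ⟩
    + (x ℕ./ N) *ᶻ + N                          ∎)))
    where
    open ≡-Reasoning
    cancel : ∀ r s → (r +ᶻ s) -ᶻ r ≡ s
    cancel = solve-∀

  toℕ-unique : ∀ {c d : Fin N} → + toℕ c ≡ + toℕ d [mod + N ] → c ≡ d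
  toℕ-unique {c} {d} (mod-intro p) = toℕ-injective (ℤ.+-injective (ℤ.i-j≡0⇒i≡j (+ toℕ c) (+ toℕ d)
    (ℤ.∣i∣≡0⇒i≡0 (small (abs (+ toℕ c -ᶻ + toℕ d)) (∣⇒∣ᵤ p) bound))))
    where
    small : ∀ k → N ℕ.∣ k → k < N → k ≡ 0
    small zero    _ _ = refl
    small (suc k) q l = contradiction (ℕ.∣⇒≤ q) (ℕ.<⇒≱ l)
    bound : abs (+ toℕ c -ᶻ + toℕ d) < N
    bound = subst (_< N) (cong abs (sym (ℤ.m-n≡m⊖n (toℕ c) (toℕ d))))
      (ℕ.≤-<-trans (ℤ.∣m⊝n∣≤m⊔n (toℕ c) (toℕ d)) (ℕ.⊔-lub (toℕ<n c) (toℕ<n d)))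

  residue : ℤ → Fin N
  residue a = fromℕ< (n%ℕd<d a N)

  residue-≡ : ∀ a → + toℕ (residue a) ≡ a [mod + N ]
  residue-≡ a = ≡-mod-sym (mod-intro (divides (a /ℕ N) (begin
    a -ᶻ + toℕ (residue a)                        ≡⟨ cong (λ r → a -ᶻ + r) (toℕ-fromℕ< (n%ℕd<d a N)) ⟩
    a -ᶻ + (a %ℕ N)                               ≡⟨ cong (_-ᶻ + (a %ℕ N)) (a≡a%ℕn+[a/ℕn]*n a N) ⟩
    (+ (a %ℕ N) +ᶻ (a /ℕ N) *ᶻ + N) -ᶻ + (a %ℕ N) ≡⟨ cancel (+ (a %ℕ N)) ((a /ℕ N) *ᶻ + N) ⟩
    (a /ℕ N) *ᶻ + N                               ∎)))
    where
    open ≡-Reasoning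
    cancel : ∀ r s → (r +ᶻ s) -ᶻ r ≡ s
    cancel = solve-∀

  +ₘ-≡ : ∀ (c d : Fin N) → + toℕ (c +ₘ d) ≡ + toℕ c +ᶻ + toℕ d [mod + N ]
  +ₘ-≡ c d = mod-≡ (toℕ c + toℕ d)

  *ₘ-≡ : ∀ (c d : Fin N) → + toℕ (c *ₘ d) ≡ + toℕ c *ᶻ + toℕ d [mod + N ]
  *ₘ-≡ c d = subst (λ e → + toℕ (c *ₘ d) ≡ e [mod + N ]) (ℤ.pos-* (toℕ c) (toℕ d)) (mod-≡ (toℕ c * toℕ d))

  0ₘ-≡ : + toℕ (0ₘ {N}) ≡ + 0 [mod + N ]
  0ₘ-≡ = mod-≡ 0

  ∣⇒≡0ₘ : ∀ {c : Fin N} → + N ∣ᶻ + toℕ c → c ≡ 0ₘ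
  ∣⇒≡0ₘ p = toℕ-unique (≡-mod-trans (∣⇒≡0-mod p) (≡-mod-sym 0ₘ-≡))

  ≡0ₘ⇒∣ : ∀ {c : Fin N} → c ≡ 0ₘ → + N ∣ᶻ + toℕ c
  ≡0ₘ⇒∣ refl = ∣-resp-≡-mod 0ₘ-≡ (divides (+ 0) refl)

  module _ {n : ℕ} where

    infix 4 _≋_
    _≋_ : (u v : Fin n → ℤ) → Set
    u ≋ v = ∀ j → u j ≡ v j [mod + N ]

    ⟦_⟧ : (Fin n → ℤ) → Word N n
    ⟦ v ⟧ = tabulate (residue ∘ v)

    ⟪_⟫ : Word N n → Fin n → ℤ
    ⟪ w ⟫ j = + toℕ (lookup w j)

    ⟪⟦_⟧⟫ : ∀ v → ⟪ ⟦ v ⟧ ⟫ ≋ v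
    ⟪⟦ v ⟧⟫ j rewrite lookup∘tabulate (residue ∘ v) j = residue-≡ (v j)

    ⟪⟫-injective : ∀ {u w} → ⟪ u ⟫ ≋ ⟪ w ⟫ → u ≡ w
    ⟪⟫-injective {u} {w} p = begin
      u                     ≡⟨ tabulate∘lookup u ⟨
      tabulate (lookup u)   ≡⟨ tabulate-cong (toℕ-unique ∘ p) ⟩
      tabulate (lookup w)   ≡⟨ tabulate∘lookup w ⟩
      w                     ∎
      where open ≡-Reasoning

    ⟪+ᵂ⟫ : ∀ u w → ⟪ u +ᵂ w ⟫ ≋ (λ j → ⟪ u ⟫ j +ᶻ ⟪ w ⟫ j)
    ⟪+ᵂ⟫ u w j rewrite lookup-zipWith _+ₘ_ j u w = +ₘ-≡ (lookup u j) (lookup w j)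

    ⟪·ᵂ⟫ : ∀ a w → ⟪ a ·ᵂ w ⟫ ≋ (λ j → + toℕ a *ᶻ ⟪ w ⟫ j)
    ⟪·ᵂ⟫ a w j rewrite lookup-map j (a *ₘ_) w = *ₘ-≡ a (lookup w j)

    ⟪0ᵂ⟫ : ⟪ 0ᵂ ⟫ ≋ (λ _ → + 0)
    ⟪0ᵂ⟫ j rewrite lookup-replicate {n = n} j (0ₘ {N}) = 0ₘ-≡

    module _ (C : Code N n) where

      record Lift (v : Fin n → ℤ) : Set where
        constructor lift
        field lower : ⟦ v ⟧ ∈ Words C

      Lift-cong : ∀ {u v} → u ≋ v → Lift u → Lift v
      Lift-cong {u} {v} p (lift u∈C) = lift (subst (_∈ Words C) (⟪⟫-injective λ j →
        ≡-mod-trans (⟪⟦ u ⟧⟫ j) (≡-mod-trans (p j) (≡-mod-sym (⟪⟦ v ⟧⟫ j)))) u∈C)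

      Lift⁺ : ∀ {w} → w ∈ Words C → Lift ⟪ w ⟫
      Lift⁺ {w} w∈C = lift (subst (_∈ Words C) (⟪⟫-injective (≡-mod-sym ∘ ⟪⟦ ⟪ w ⟫ ⟧⟫)) w∈C)

      Lift⁻ : ∀ {w} → Lift ⟪ w ⟫ → w ∈ Words C
      Lift⁻ {w} (lift w∈C) = subst (_∈ Words C) (⟪⟫-injective ⟪⟦ ⟪ w ⟫ ⟧⟫) w∈C

      Lift-+ : ∀ {u v} → Lift u → Lift v → Lift (λ j → u j +ᶻ v j)
      Lift-+ {u} {v} (lift p) (lift q) = Lift-cong
        (λ j → ≡-mod-trans (⟪+ᵂ⟫ ⟦ u ⟧ ⟦ v ⟧ j) (≡-mod-+ (⟪⟦ u ⟧⟫ j) (⟪⟦ v ⟧⟫ j)))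
        (Lift⁺ (+-closed C p q))

      Lift-* : ∀ k {v} → Lift v → Lift (λ j → k *ᶻ v j)
      Lift-* k {v} (lift p) = Lift-cong
        (λ j → ≡-mod-trans (⟪·ᵂ⟫ (residue k) ⟦ v ⟧ j) (≡-mod-* (residue-≡ k) (⟪⟦ v ⟧⟫ j)))
        (Lift⁺ (·-closed C (residue k) p))

      Lift-0 : Lift (λ _ → + 0)
      Lift-0 = Lift-cong ⟪0ᵂ⟫ (Lift⁺ (0-closed C))

    Combination : ∀ {m} → Matrix N m n → (Fin n → ℤ) → Set
    Combination []      v = ∀ j → + N ∣ᶻ v j
    Combination (r ∷ g) v = ∃[ a ] Combination g (λ j → v j -ᶻ a *ᶻ ⟪ r ⟫ j)

    Combination-cong : ∀ {m} (g : Matrix N m n) {u v} → u ≋ v → Combination g u → Combination g v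
    Combination-cong []      p q       = λ j → ∣-resp-≡-mod (≡-mod-sym (p j)) (q j)
    Combination-cong (r ∷ g) p (a , q) = a , Combination-cong g (λ j → ≡-mod-+ (p j) ≡-mod-refl) q

    Combination-0 : ∀ {m} (g : Matrix N m n) → Combination g (λ _ → + 0)
    Combination-0 []      = λ j → divides (+ 0) refl
    Combination-0 (r ∷ g) = + 0 , Combination-0 g

    Combination-+ : ∀ {m} (g : Matrix N m n) {u v} → Combination g u → Combination g v →
                    Combination g (λ j → u j +ᶻ v j)
    Combination-+ []      p q = λ j → ∣m∣n⇒∣m+n (p j) (q j)
    Combination-+ (r ∷ g) {u} {v} (a , p) (b , q) =
      a +ᶻ b , Combination-cong g (λ j → ≡-mod-reflexive (rearrange (u j) (v j) a b (⟪ r ⟫ j))) (Combination-+ g p q)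
      where
      rearrange : ∀ u v a b r → (u -ᶻ a *ᶻ r) +ᶻ (v -ᶻ b *ᶻ r) ≡ (u +ᶻ v) -ᶻ (a +ᶻ b) *ᶻ r
      rearrange = solve-∀

    Combination-* : ∀ {m} (g : Matrix N m n) k {v} → Combination g v → Combination g (λ j → k *ᶻ v j)
    Combination-* []      k p = λ j → ∣n⇒∣m*n k (p j)
    Combination-* (r ∷ g) k {v} (a , p) =
      k *ᶻ a , Combination-cong g (λ j → ≡-mod-reflexive (rearrange k (v j) a (⟪ r ⟫ j))) (Combination-* g k p)
      where
      rearrange : ∀ k v a r → k *ᶻ (v -ᶻ a *ᶻ r) ≡ k *ᶻ v -ᶻ (k *ᶻ a) *ᶻ r
      rearrange = solve-∀

    Combination-row : ∀ {m} (g : Matrix N m n) i → Combination g ⟪ lookup g i ⟫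
    Combination-row (r ∷ g) zero    =
      + 1 , Combination-cong g (λ j → ≡-mod-reflexive (cancel (⟪ r ⟫ j))) (Combination-0 g)
      where
      cancel : ∀ x → + 0 ≡ x -ᶻ + 1 *ᶻ x
      cancel = solve-∀
    Combination-row (r ∷ g) (suc i) =
      + 0 , Combination-cong g (λ j → ≡-mod-reflexive (drop (⟪ lookup g i ⟫ j) (⟪ r ⟫ j)))
              (Combination-row g i)
      where
      drop : ∀ x r → x ≡ x -ᶻ + 0 *ᶻ r
      drop = solve-∀

    Span⇒Combination : ∀ {m} {g : Matrix N m n} {w} → Span g w → Combination g ⟪ w ⟫
    Span⇒Combination {g = g} zero-word = Combination-cong g (λ j → ≡-mod-sym (⟪0ᵂ⟫ j)) (Combination-0 g)
    Span⇒Combination {g = g} (row i) = Combination-row g i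
    Span⇒Combination {g = g} (add {v} {w} p q) =
      Combination-cong g (λ j → ≡-mod-sym (⟪+ᵂ⟫ v w j)) (Combination-+ g (Span⇒Combination p) (Span⇒Combination q))
    Span⇒Combination {g = g} (scale a {w} p) =
      Combination-cong g (λ j → ≡-mod-sym (⟪·ᵂ⟫ a w j)) (Combination-* g (+ toℕ a) (Span⇒Combination p))

    Combination⇒Lift : ∀ {m} (g : Matrix N m n) (C : Code N n) → (∀ i → lookup g i ∈ Words C) →
                       ∀ {v} → Combination g v → Lift C v
    Combination⇒Lift []      C rows p = Lift-cong C (λ j → ≡-mod-sym (∣⇒≡0-mod (p j))) (Lift-0 C)
    Combination⇒Lift (r ∷ g) C rows {v} (a , p) =
      Lift-cong C (λ j → ≡-mod-reflexive (cancel (v j) (a *ᶻ ⟪ r ⟫ j)))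
        (Lift-+ C (Combination⇒Lift g C (rows ∘ suc) p) (Lift-* C a (Lift⁺ C (rows zero))))
      where
      cancel : ∀ x y → (x -ᶻ y) +ᶻ y ≡ x
      cancel = solve-∀

    Lift⇒Combination : ∀ {m} (g : Matrix N m n) {v} → Lift ⟨ g ⟩ v → Combination g v
    Lift⇒Combination g {v} (lift p) = Combination-cong g ⟪⟦ v ⟧⟫ (Span⇒Combination p)

    ∃-Combination? : ∀ {m} (g : Matrix N m n) {P : (Fin n → ℤ) → Set} → (∀ v → Dec (P v)) →
                     (∀ {u v} → u ≋ v → P u → P v) → Dec (∃[ v ] Combination g v × P v)
    ∃-Combination? [] P? P-resp = map′
      (λ p → (λ _ → + 0) , (λ j → divides (+ 0) refl) , p)
      (λ { (v , q , p) → P-resp (λ j → ∣⇒≡0-mod (q j)) p })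
      (P? (λ _ → + 0))
    ∃-Combination? (r ∷ g) {P} P? P-resp = map′
      (λ { (a , u , q , p) → _ ,
           (+ toℕ a , Combination-cong g (λ j → ≡-mod-reflexive (cancel (u j) (+ toℕ a *ᶻ ⟪ r ⟫ j))) q) , p })
      (λ { (v , (a , q) , p) → residue a , _ , q , P-resp (λ j → shift a (v j) (⟪ r ⟫ j)) p })
      (any? λ a → ∃-Combination? g (λ u → P? (λ j → u j +ᶻ + toℕ a *ᶻ ⟪ r ⟫ j))
                    (λ u≋v → P-resp (λ j → ≡-mod-+ (u≋v j) ≡-mod-refl)))
      where
      cancel : ∀ x y → x ≡ (x +ᶻ y) -ᶻ y
      cancel = solve-∀
      uncancel : ∀ x y → x ≡ (x -ᶻ y) +ᶻ y
      uncancel = solve-∀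
      shift : ∀ a v r → v ≡ (v -ᶻ a *ᶻ r) +ᶻ + toℕ (residue a) *ᶻ r [mod + N ]
      shift a v r = ≡-mod-trans (≡-mod-reflexive (uncancel v (a *ᶻ r)))
        (≡-mod-+ {a = v -ᶻ a *ᶻ r} ≡-mod-refl (≡-mod-* (≡-mod-sym (residue-≡ a)) ≡-mod-refl))

    ∃-Lift? : ∀ {m} (g : Matrix N m n) {P : (Fin n → ℤ) → Set} → (∀ v → Dec (P v)) →
              (∀ {u v} → u ≋ v → P u → P v) → Dec (∃[ v ] Lift ⟨ g ⟩ v × P v)
    ∃-Lift? g P? P-resp = map′
      (λ { (v , q , p) → v , Combination⇒Lift g ⟨ g ⟩ row q , p })
      (λ { (v , q , p) → v , Lift⇒Combination g q , p })
      (∃-Combination? g P? P-resp)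

-- Codes covered by three coordinates

parity : ∀ a → (∃[ b ] a ≡ + 2 *ᶻ b) ⊎ (∃[ b ] a ≡ + 1 +ᶻ + 2 *ᶻ b)
parity a with a %ℕ 2 | n%ℕd<d a 2 | a≡a%ℕn+[a/ℕn]*n a 2
... | zero        | _ | eq = inj₁ (a /ℕ 2 , trans eq (trans (ℤ.+-identityˡ _) (ℤ.*-comm (a /ℕ 2) (+ 2))))
... | suc zero    | _ | eq = inj₂ (a /ℕ 2 , trans eq (cong (+ 1 +ᶻ_) (ℤ.*-comm (a /ℕ 2) (+ 2))))
... | suc (suc _) | s≤s (s≤s ()) | _

cut : Permutation′ 5 → (Fin 5 → ℤ) → Fin 5 → ℤ
cut π v j = [ (λ _ → v j) , (λ _ → + 0) ]′ (splitAt 3 (π ⟨$⟩ˡ j))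

⟨$⟩ʳ-cover : ∀ {n} (π : Permutation′ n) {P : Fin n → Set} → (∀ k → P (π ⟨$⟩ʳ k)) → ∀ j → P j
⟨$⟩ʳ-cover π {P} p j = subst P (inverseʳ π) (p (π ⟨$⟩ˡ j))

row₁ row₂ : ℤ → Fin 5 → ℤ
row₁ h = lookup (h ∷ h ∷ + 0 ∷ + 0 ∷ + 0 ∷ [])
row₂ h = lookup (h ∷ + 0 ∷ h ∷ + 1 ∷ - + 1 ∷ [])

module ThreeCover {D : ℤ} {L : (Fin 5 → ℤ) → Set}
         (L-cong : ∀ {u v} → (∀ j → u j ≡ v j [mod D ]) → L u → L v)
         (L-+ : ∀ {u v} → L u → L v → L (λ j → u j +ᶻ v j))
         (L-* : ∀ k {v} → L v → L (λ j → k *ᶻ v j))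
         (L-sum : ∀ {v} → L v → D ∣ᶻ sum v)
         (gcd-one : ∀ e → e ∣ᶻ D → (∀ {v} → L v → ∀ j → e ∣ᶻ v j) → e ∣ᶻ + 1)
         (nonzero : ∀ i → ∃[ v ] L v × ¬ D ∣ᶻ v i)
         (generator : ∀ l → ∃[ v ] L v × v l ∣ᶻ D × (∀ {u} → L u → v l ∣ᶻ u l))
         (indecomposable : ∀ π → ¬ (∀ {v} → L v → L (cut π v)))
         where

  nonzero₂ : ∀ p q → ∃[ y ] L y × ¬ D ∣ᶻ y p × ¬ D ∣ᶻ y q
  nonzero₂ p q with nonzero p | nonzero q
  ... | u , u∈L , up | v , v∈L , vq with D ∣ᶻ? u q | D ∣ᶻ? v p
  ... | no uq  | _      = u , u∈L , up , uq
  ... | yes _  | no vp  = v , v∈L , vp , vq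
  ... | yes uq | yes vp = _ , L-+ u∈L v∈L , (λ d → up (∣m+n∣n⇒∣m d vp)) , (λ d → vq (∣m+n∣m⇒∣n d uq))

  Cover : (p q r : Fin 5) → Set
  Cover p q r = ∀ {v} → L v → D ∣ᶻ v p ⊎ D ∣ᶻ v q ⊎ D ∣ᶻ v r

  third : ∀ {p q r} → Cover p q r → ∀ {v} → L v → ¬ D ∣ᶻ v p → ¬ D ∣ᶻ v q → D ∣ᶻ v r
  third cover v∈L vp vq with cover v∈L
  ... | inj₁ d        = contradiction d vp
  ... | inj₂ (inj₁ d) = contradiction d vq
  ... | inj₂ (inj₂ d) = d

  third-zero : ∀ {p q r} → Cover p q r → ∀ {x} → L x → D ∣ᶻ x p → D ∣ᶻ x q → D ∣ᶻ x r
  third-zero {p} {q} cover x∈L xp xq with nonzero₂ p q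
  ... | y , y∈L , yp , yq =
    ∣m+n∣m⇒∣n (third cover (L-+ y∈L x∈L) (λ d → yp (∣m+n∣n⇒∣m d xp)) (λ d → yq (∣m+n∣n⇒∣m d xq)))
              (third cover y∈L yp yq)

  rotate : ∀ {p q r} → Cover p q r → Cover q r p
  rotate cover v∈L with cover v∈L
  ... | inj₁ d        = inj₂ (inj₂ d)
  ... | inj₂ (inj₁ d) = inj₁ d
  ... | inj₂ (inj₂ d) = inj₂ (inj₁ d)

  reflect : ∀ {p q r} → Cover p q r → Cover r q p
  reflect cover v∈L with cover v∈L
  ... | inj₁ d        = inj₂ (inj₂ d)
  ... | inj₂ (inj₁ d) = inj₂ (inj₁ d)
  ... | inj₂ (inj₂ d) = inj₁ d

  twice-q : ∀ {p q r} → Cover p q r → ∀ {x} → L x → D ∣ᶻ x p → D ∣ᶻ + 2 *ᶻ x q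
  twice-q {p} {q} {r} cover {x} x∈L xp with D ∣ᶻ? x r
  ... | yes xr = ∣n⇒∣m*n (+ 2) (third-zero (rotate (rotate (reflect cover))) x∈L xp xr)
  ... | no xr with nonzero₂ p q
  ...   | y , y∈L , yp , yq = subst (D ∣ᶻ_) (difference (y q) (x q)) (∣m∣n⇒∣m-n plus minus)
    where
    yr : D ∣ᶻ y r
    yr = third cover y∈L yp yq
    plus : D ∣ᶻ y q +ᶻ x q
    plus = third (rotate (rotate cover)) (L-+ y∈L x∈L)
             (λ d → xr (∣m+n∣m⇒∣n d yr)) (λ d → yp (∣m+n∣n⇒∣m d xp))
    minus : D ∣ᶻ y q +ᶻ - + 1 *ᶻ x q
    minus = third (rotate (rotate cover)) (L-+ y∈L (L-* (- + 1) x∈L))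
              (λ d → xr (subst (D ∣ᶻ_) (negate (x r)) (∣n⇒∣m*n (- + 1) (∣m+n∣m⇒∣n d yr))))
              (λ d → yp (∣m+n∣n⇒∣m d (∣n⇒∣m*n (- + 1) xp)))
      where
      negate : ∀ a → - + 1 *ᶻ (- + 1 *ᶻ a) ≡ a
      negate = solve-∀
    difference : ∀ a b → (a +ᶻ b) -ᶻ (a +ᶻ - + 1 *ᶻ b) ≡ + 2 *ᶻ b
    difference = solve-∀

  twice : ∀ {p q r} → Cover p q r → ∀ {x} → L x → D ∣ᶻ + 2 *ᶻ x q
  twice cover x∈L with cover x∈L
  ... | inj₁ xp        = twice-q cover x∈L xp
  ... | inj₂ (inj₁ xq) = ∣n⇒∣m*n (+ 2) xq
  ... | inj₂ (inj₂ xr) = twice-q (reflect cover) x∈L xr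

  half : ∀ {p q r} → Cover p q r → ∃[ h ] D ≡ + 2 *ᶻ h × ¬ D ∣ᶻ h
  half {p} {q} {r} cover with nonzero q
  ... | x , x∈L , xq with twice cover x∈L
  ...   | divides c eq with parity c
  ...     | inj₁ (b , refl) = contradiction (divides b (ℤ.*-cancelˡ-≡ (+ 2) _ _ (trans eq (ℤ.*-assoc (+ 2) b D)))) xq
  ...     | inj₂ (b , refl) = x q -ᶻ b *ᶻ D ,
    trans (isolate b D) (trans (cong (_-ᶻ + 2 *ᶻ (b *ᶻ D)) (sym eq)) (factor (x q) (b *ᶻ D))) ,
    λ d → xq (∣m+n∣n⇒∣m d (∣m⇒∣-m (∣n⇒∣m*n b ∣-refl)))
    where
    isolate : ∀ b D → D ≡ (+ 1 +ᶻ + 2 *ᶻ b) *ᶻ D -ᶻ + 2 *ᶻ (b *ᶻ D)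
    isolate = solve-∀
    factor : ∀ x y → + 2 *ᶻ x -ᶻ + 2 *ᶻ y ≡ + 2 *ᶻ (x -ᶻ y)
    factor = solve-∀

  Standard : ℤ → Set
  Standard h = Σ[ π ∈ Permutation′ 5 ] L (row₁ h ∘ (π ⟨$⟩ˡ_)) × L (row₂ h ∘ (π ⟨$⟩ˡ_)) ×
    (∀ {v} → L v → ∃[ α ] ∃[ β ] (∀ k → v (π ⟨$⟩ʳ k) ≡ α *ᶻ row₁ h k +ᶻ β *ᶻ row₂ h k [mod D ]))

  module _ {h : ℤ} (D≡2h : D ≡ + 2 *ᶻ h) (D∤h : ¬ D ∣ᶻ h) where

    D∣2h : D ∣ᶻ + 2 *ᶻ h
    D∣2h = ∣-reflexive D≡2h

    h+h≡0 : h +ᶻ h ≡ + 0 [mod D ]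
    h+h≡0 = ∣⇒≡0-mod (subst (D ∣ᶻ_) (double h) D∣2h)
      where
      double : ∀ h → + 2 *ᶻ h ≡ h +ᶻ h
      double = solve-∀

    halves : ∀ {a} → D ∣ᶻ + 2 *ᶻ a → D ∣ᶻ a ⊎ a ≡ h [mod D ]
    halves {a} d with *-cancelˡ-∣ (+ 2) {h} {a} (subst (_∣ᶻ + 2 *ᶻ a) D≡2h d)
    ... | divides c refl with parity c
    ...   | inj₁ (b , refl) = inj₁ (divides b (trans (rearrange b h) (cong (b *ᶻ_) (sym D≡2h))))
      where
      rearrange : ∀ b h → (+ 2 *ᶻ b) *ᶻ h ≡ b *ᶻ (+ 2 *ᶻ h)
      rearrange = solve-∀
    ...   | inj₂ (b , refl) = inj₂ (mod-intro (divides b (trans (rearrange b h) (cong (b *ᶻ_) (sym D≡2h)))))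
      where
      rearrange : ∀ b h → (+ 1 +ᶻ + 2 *ᶻ b) *ᶻ h -ᶻ h ≡ b *ᶻ (+ 2 *ᶻ h)
      rearrange = solve-∀

    ≡h⇒≢0 : ∀ {a} → a ≡ h [mod D ] → ¬ D ∣ᶻ a
    ≡h⇒≢0 a≡h d = D∤h (∣-resp-≡-mod (≡-mod-sym a≡h) d)

    data Shape (a b c : ℤ) : Set where
      0-0-0 : a ≡ + 0 [mod D ] → b ≡ + 0 [mod D ] → c ≡ + 0 [mod D ] → Shape a b c
      0-h-h  : a ≡ + 0 [mod D ] → b ≡ h [mod D ] → c ≡ h [mod D ] → Shape a b c
      h-0-h  : a ≡ h [mod D ] → b ≡ + 0 [mod D ] → c ≡ h [mod D ] → Shape a b c
      h-h-0  : a ≡ h [mod D ] → b ≡ h [mod D ] → c ≡ + 0 [mod D ] → Shape a b c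

    shape : ∀ {p q r} → Cover p q r → ∀ {x} → L x → Shape (x p) (x q) (x r)
    shape {p} {q} {r} cover {x} x∈L
      with halves (twice (rotate (rotate cover)) x∈L) | halves (twice cover x∈L) | halves (twice (rotate cover) x∈L)
    ... | inj₁ a | inj₁ b | inj₁ c = 0-0-0 (∣⇒≡0-mod a) (∣⇒≡0-mod b) (∣⇒≡0-mod c)
    ... | inj₁ a | inj₂ b | inj₂ c = 0-h-h (∣⇒≡0-mod a) b c
    ... | inj₂ a | inj₁ b | inj₂ c = h-0-h a (∣⇒≡0-mod b) c
    ... | inj₂ a | inj₂ b | inj₁ c = h-h-0 a b (∣⇒≡0-mod c)
    ... | inj₁ a | inj₁ b | inj₂ c = contradiction (third-zero cover x∈L a b) (≡h⇒≢0 c)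
    ... | inj₁ a | inj₂ b | inj₁ c = contradiction (third-zero (rotate (rotate cover)) x∈L c a) (≡h⇒≢0 b)
    ... | inj₂ a | inj₁ b | inj₁ c = contradiction (third-zero (rotate cover) x∈L b c) (≡h⇒≢0 a)
    ... | inj₂ a | inj₂ b | inj₂ c = contradiction (third cover x∈L (≡h⇒≢0 a) (≡h⇒≢0 b)) (≡h⇒≢0 c)

    shape-sum : ∀ {a b c} → Shape a b c → a +ᶻ (b +ᶻ c) ≡ + 0 [mod D ]
    shape-sum (0-0-0 a b c) = ≡-mod-+ a (≡-mod-+ b c)
    shape-sum (0-h-h a b c)  = ≡-mod-+ a (≡-mod-trans (≡-mod-+ b c) h+h≡0)
    shape-sum (h-0-h a b c)  =
      ≡-mod-trans (≡-mod-+ a (≡-mod-+ b c)) (≡-mod-trans (≡-mod-reflexive (cong (h +ᶻ_) (ℤ.+-identityˡ h))) h+h≡0)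
    shape-sum (h-h-0 a b c)  =
      ≡-mod-trans (≡-mod-+ a (≡-mod-+ b c)) (≡-mod-trans (≡-mod-reflexive (cong (h +ᶻ_) (ℤ.+-identityʳ h))) h+h≡0)

    halves-∣ : ∀ {g a} → g ∣ᶻ D → g ∣ᶻ h → D ∣ᶻ + 2 *ᶻ a → g ∣ᶻ a
    halves-∣ g∣D g∣h d with halves d
    ... | inj₁ D∣a           = ∣-trans g∣D D∣a
    ... | inj₂ (mod-intro e) = ∣m+n∣n⇒∣m (∣-trans g∣D e) (∣m⇒∣-m g∣h)

    module _ (π : Permutation′ 5) (cover : Cover (π ⟨$⟩ʳ 0F) (π ⟨$⟩ʳ 1F) (π ⟨$⟩ʳ 2F)) where

      private
        p q r l m : Fin 5
        p = π ⟨$⟩ʳ 0F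
        q = π ⟨$⟩ʳ 1F
        r = π ⟨$⟩ʳ 2F
        l = π ⟨$⟩ʳ 3F
        m = π ⟨$⟩ʳ 4F

      outer-sum : ∀ {x} → L x → D ∣ᶻ x l +ᶻ x m
      outer-sum {x} x∈L = subst (D ∣ᶻ_) (isolate (x p) (x q) (x r) (x l) (x m)) (∣m∣n⇒∣m-n
        (subst (D ∣ᶻ_) (sum-permute x π) (L-sum x∈L))
        (∣-resp-≡-mod (shape-sum (shape cover x∈L)) (divides (+ 0) refl)))
        where
        isolate : ∀ a b c d e → (a +ᶻ (b +ᶻ (c +ᶻ (d +ᶻ (e +ᶻ + 0))))) -ᶻ (a +ᶻ (b +ᶻ c)) ≡ d +ᶻ e
        isolate = solve-∀

      not-split : ¬ (∀ {v} → L v → ∃[ u ] L u × u p ≡ v p [mod D ] × u q ≡ v q [mod D ] × u r ≡ v r [mod D ] ×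
                                             u l ≡ + 0 [mod D ] × u m ≡ + 0 [mod D ])
      not-split split = indecomposable π cut∈L
        where
        cut∈L : ∀ {v} → L v → L (cut π v)
        cut∈L {v} v∈L with split v∈L
        ... | u , u∈L , up , uq , ur , ul , um = L-cong (⟨$⟩ʳ-cover π agree) u∈L
          where
          cut-at : ∀ k → cut π v (π ⟨$⟩ʳ k) ≡ [ (λ _ → v (π ⟨$⟩ʳ k)) , (λ _ → + 0) ]′ (splitAt 3 k)
          cut-at k = cong (λ i → [ (λ _ → v (π ⟨$⟩ʳ k)) , (λ _ → + 0) ]′ (splitAt 3 i)) (inverseˡ π)

          agree : ∀ k → u (π ⟨$⟩ʳ k) ≡ cut π v (π ⟨$⟩ʳ k) [mod D ]
          agree 0F = ≡-mod-trans up (≡-mod-reflexive (sym (cut-at 0F)))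
          agree 1F = ≡-mod-trans uq (≡-mod-reflexive (sym (cut-at 1F)))
          agree 2F = ≡-mod-trans ur (≡-mod-reflexive (sym (cut-at 2F)))
          agree 3F = ≡-mod-trans ul (≡-mod-reflexive (sym (cut-at 3F)))
          agree 4F = ≡-mod-trans um (≡-mod-reflexive (sym (cut-at 4F)))

      unit : ∃[ w ] L w × w l ≡ + 1
      unit with generator l
      ... | v , v∈L , δ∣D , δ∣l with bézout (v l) h
      ...   | α , β , g∣δ , g∣h with gcd-one _ (∣-trans g∣δ δ∣D) (λ x∈L → ⟨$⟩ʳ-cover π (entries x∈L))
        where
        g : ℤ
        g = α *ᶻ v l +ᶻ β *ᶻ h
        entries : ∀ {x} → L x → ∀ k → g ∣ᶻ x (π ⟨$⟩ʳ k)
        entries x∈L 0F = halves-∣ (∣-trans g∣δ δ∣D) g∣h (twice (rotate (rotate cover)) x∈L)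
        entries x∈L 1F = halves-∣ (∣-trans g∣δ δ∣D) g∣h (twice cover x∈L)
        entries x∈L 2F = halves-∣ (∣-trans g∣δ δ∣D) g∣h (twice (rotate cover) x∈L)
        entries x∈L 3F = ∣-trans g∣δ (δ∣l x∈L)
        entries x∈L 4F = ∣m+n∣m⇒∣n (∣-trans (∣-trans g∣δ δ∣D) (outer-sum x∈L)) (∣-trans g∣δ (δ∣l x∈L))
      ...     | divides s 1≡sg with parity (v l)
      ...       | inj₂ (c , δ≡1+2c) = _ , L-* (quotient δ∣1) v∈L , sym (equality δ∣1)
        where
        δ∣2 : v l ∣ᶻ + 2
        δ∣2 = subst (v l ∣ᶻ_) (trans (expand s α β (v l) h) (cong (+ 2 *ᶻ_) (sym 1≡sg)))
          (∣m∣n⇒∣m+n (∣n⇒∣m*n (+ 2 *ᶻ s *ᶻ α) (∣-refl {v l})) (∣n⇒∣m*n (s *ᶻ β) (subst (v l ∣ᶻ_) D≡2h δ∣D)))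
          where
          expand : ∀ s α β δ h → (+ 2 *ᶻ s *ᶻ α) *ᶻ δ +ᶻ (s *ᶻ β) *ᶻ (+ 2 *ᶻ h) ≡ + 2 *ᶻ (s *ᶻ (α *ᶻ δ +ᶻ β *ᶻ h))
          expand = solve-∀
        δ∣1 : v l ∣ᶻ + 1
        δ∣1 = ∣m+n∣n⇒∣m (subst (v l ∣ᶻ_) δ≡1+2c ∣-refl) (∣m⇒∣m*n c δ∣2)
      ...       | inj₁ (c , δ≡2c) with parity h
      ...         | inj₁ (b , h≡2b) = contradiction (subst (+ 2 ∣ᶻ_) (sym 1≡sg)
          (∣n⇒∣m*n s (∣m∣n⇒∣m+n (∣n⇒∣m*n α (divides c (trans δ≡2c (ℤ.*-comm (+ 2) c))))
                                (∣n⇒∣m*n β (divides b (trans h≡2b (ℤ.*-comm (+ 2) b)))))))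
          (from-no (+ 2 ∣ᶻ? + 1))
      ...         | inj₂ (b , h≡1+2b) = ⊥-elim (not-split λ {x} x∈L → _ , L-* h x∈L ,
          keep (twice (rotate (rotate cover)) x∈L) , keep (twice cover x∈L) , keep (twice (rotate cover) x∈L) ,
          kill (even x∈L) ,
          ∣⇒≡0-mod (∣m+n∣m⇒∣n (subst (D ∣ᶻ_) (ℤ.*-distribˡ-+ h (x l) (x m)) (∣n⇒∣m*n h (outer-sum x∈L)))
                               (kill′ (even x∈L))))
        where
        keep : ∀ {a} → D ∣ᶻ + 2 *ᶻ a → h *ᶻ a ≡ a [mod D ]
        keep {a} d = mod-intro (subst (D ∣ᶻ_) (trans (expand b a) (cong (λ h → h *ᶻ a -ᶻ a) (sym h≡1+2b))) (∣n⇒∣m*n b d))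
          where
          expand : ∀ b a → b *ᶻ (+ 2 *ᶻ a) ≡ (+ 1 +ᶻ + 2 *ᶻ b) *ᶻ a -ᶻ a
          expand = solve-∀
        even : ∀ {x} → L x → + 2 ∣ᶻ x l
        even x∈L = ∣-trans (divides c (trans δ≡2c (ℤ.*-comm (+ 2) c))) (δ∣l x∈L)
        kill′ : ∀ {a} → + 2 ∣ᶻ a → D ∣ᶻ h *ᶻ a
        kill′ (divides e refl) = divides e (trans (rearrange h e) (cong (e *ᶻ_) (sym D≡2h)))
          where
          rearrange : ∀ h e → h *ᶻ (e *ᶻ + 2) ≡ e *ᶻ (+ 2 *ᶻ h)
          rearrange = solve-∀
        kill : ∀ {a} → + 2 ∣ᶻ a → h *ᶻ a ≡ + 0 [mod D ]
        kill d = ∣⇒≡0-mod (kill′ d)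

      module _ {w : Fin 5 → ℤ} (w∈L : L w) (wl : w l ≡ + 1 [mod D ]) where

        reduce : (Fin 5 → ℤ) → Fin 5 → ℤ
        reduce x j = x j +ᶻ - x l *ᶻ w j

        reduce∈L : ∀ {x} → L x → L (reduce x)
        reduce∈L {x} x∈L = L-+ x∈L (L-* (- x l) w∈L)

        reduce-0 : ∀ {x j} → w j ≡ + 0 [mod D ] → reduce x j ≡ x j [mod D ]
        reduce-0 {x} {j} wj = ≡-mod-trans
          (≡-mod-+ {a = x j} ≡-mod-refl (≡-mod-* {a = - x l} ≡-mod-refl wj))
          (≡-mod-reflexive (zero-term (x j) (x l)))
          where
          zero-term : ∀ a b → a +ᶻ - b *ᶻ + 0 ≡ a
          zero-term = solve-∀

        reduce-l : ∀ {x} → reduce x l ≡ + 0 [mod D ]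
        reduce-l {x} = ≡-mod-trans
          (≡-mod-+ {a = x l} ≡-mod-refl (≡-mod-* {a = - x l} ≡-mod-refl wl))
          (≡-mod-reflexive (cancel (x l)))
          where
          cancel : ∀ a → a +ᶻ - a *ᶻ + 1 ≡ + 0
          cancel = solve-∀

        reduce-m : ∀ {x} → L x → reduce x m ≡ + 0 [mod D ]
        reduce-m {x} x∈L = ∣⇒≡0-mod
          (∣m+n∣m⇒∣n (outer-sum (reduce∈L x∈L)) (∣-resp-≡-mod (reduce-l {x}) (divides (+ 0) refl)))

        restore : ∀ x j → x j ≡ reduce x j +ᶻ x l *ᶻ w j
        restore x j = identity (x j) (x l) (w j)
          where
          identity : ∀ a b c → a ≡ (a +ᶻ - b *ᶻ c) +ᶻ b *ᶻ c
          identity = solve-∀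

        not-zero-shape : ¬ (w p ≡ + 0 [mod D ] × w q ≡ + 0 [mod D ] × w r ≡ + 0 [mod D ])
        not-zero-shape (wp , wq , wr) = not-split λ {v} v∈L →
          reduce v , reduce∈L v∈L , reduce-0 {v} wp , reduce-0 {v} wq , reduce-0 {v} wr , reduce-l {v} , reduce-m v∈L

      Agrees : (u v : Fin 5 → ℤ) → Set
      Agrees u v = ∀ k → u (π ⟨$⟩ʳ k) ≡ v k [mod D ]

      not-both : ∀ {a b} → L a → L b → Agrees a (row₁ h) →
                 Agrees b (lookup (h ∷ + 0 ∷ h ∷ + 0 ∷ + 0 ∷ [])) → ⊥
      not-both {a} {b} a∈L b∈L a≡ b≡ = not-split λ {v} v∈L → inner v (shape cover v∈L)
        where
        inner : ∀ v → Shape (v p) (v q) (v r) →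
                ∃[ u ] L u × u p ≡ v p [mod D ] × u q ≡ v q [mod D ] × u r ≡ v r [mod D ] ×
                             u l ≡ + 0 [mod D ] × u m ≡ + 0 [mod D ]
        inner v (0-0-0 vp vq vr) = (λ j → + 0 *ᶻ a j) , L-* (+ 0) a∈L ,
          ≡-mod-sym vp , ≡-mod-sym vq , ≡-mod-sym vr , ≡-mod-refl , ≡-mod-refl
        inner v (h-h-0 vp vq vr) = a , a∈L ,
          ≡-mod-trans (a≡ 0F) (≡-mod-sym vp) , ≡-mod-trans (a≡ 1F) (≡-mod-sym vq) ,
          ≡-mod-trans (a≡ 2F) (≡-mod-sym vr) , a≡ 3F , a≡ 4F
        inner v (h-0-h vp vq vr) = b , b∈L ,
          ≡-mod-trans (b≡ 0F) (≡-mod-sym vp) , ≡-mod-trans (b≡ 1F) (≡-mod-sym vq) ,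
          ≡-mod-trans (b≡ 2F) (≡-mod-sym vr) , b≡ 3F , b≡ 4F
        inner v (0-h-h vp vq vr) = _ , L-+ a∈L b∈L ,
          ≡-mod-trans (≡-mod-+ (a≡ 0F) (b≡ 0F)) (≡-mod-trans h+h≡0 (≡-mod-sym vp)) ,
          ≡-mod-trans (≡-mod-+ (a≡ 1F) (b≡ 1F)) (≡-mod-trans (≡-mod-reflexive (ℤ.+-identityʳ h)) (≡-mod-sym vq)) ,
          ≡-mod-trans (≡-mod-+ (a≡ 2F) (b≡ 2F)) (≡-mod-trans (≡-mod-reflexive (ℤ.+-identityˡ h)) (≡-mod-sym vr)) ,
          ≡-mod-+ (a≡ 3F) (b≡ 3F) , ≡-mod-+ (a≡ 4F) (b≡ 4F)

      assemble : ∀ {a w} → L a → L w → Agrees a (row₁ h) → Agrees w (row₂ h) → Standard h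
      assemble {a} {w} a∈L w∈L a≡ w≡ =
        π , standard-row a∈L a≡ , standard-row w∈L w≡ ,
        λ v∈L → restored v∈L (rest v∈L (shape cover (v′∈L v∈L)))
        where
        standard-row : ∀ {u v} → L u → Agrees u v → L (v ∘ (π ⟨$⟩ˡ_))
        standard-row {u} {v} u∈L u≡v = L-cong (⟨$⟩ʳ-cover π λ k →
          ≡-mod-trans (u≡v k) (≡-mod-reflexive (cong v (sym (inverseˡ π))))) u∈L

        reduced : (Fin 5 → ℤ) → Fin 5 → ℤ
        reduced = reduce w∈L (w≡ 3F)

        module _ {v : Fin 5 → ℤ} (v∈L : L v) where

          v′∈L : L (reduced v)
          v′∈L = reduce∈L w∈L (w≡ 3F) v∈L

          v′l : reduced v l ≡ + 0 [mod D ]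
          v′l = reduce-l w∈L (w≡ 3F) {v}

          v′m : reduced v m ≡ + 0 [mod D ]
          v′m = reduce-m w∈L (w≡ 3F) v∈L

          rest : Shape (reduced v p) (reduced v q) (reduced v r) →
                 ∃[ α ] Agrees (reduced v) (λ k → α *ᶻ row₁ h k)
          rest (0-0-0 vp vq vr) = + 0 , λ { 0F → vp ; 1F → vq ; 2F → vr ; 3F → v′l ; 4F → v′m }
          rest (h-h-0 vp vq vr) = + 1 , λ { 0F → one vp ; 1F → one vq ; 2F → vr ; 3F → v′l ; 4F → v′m }
            where
            one : ∀ {x} → x ≡ h [mod D ] → x ≡ + 1 *ᶻ h [mod D ]
            one x≡h = ≡-mod-trans x≡h (≡-mod-reflexive (sym (ℤ.*-identityˡ h)))
          rest (h-0-h vp vq vr) = ⊥-elim (not-both a∈L v′∈L a≡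
            λ { 0F → vp ; 1F → vq ; 2F → vr ; 3F → v′l ; 4F → v′m })
          rest (0-h-h vp vq vr) = ⊥-elim (not-both a∈L (L-+ a∈L v′∈L) a≡
            λ { 0F → ≡-mod-trans (≡-mod-+ (a≡ 0F) vp) (≡-mod-reflexive (ℤ.+-identityʳ h))
              ; 1F → ≡-mod-trans (≡-mod-+ (a≡ 1F) vq) h+h≡0
              ; 2F → ≡-mod-trans (≡-mod-+ (a≡ 2F) vr) (≡-mod-reflexive (ℤ.+-identityˡ h))
              ; 3F → ≡-mod-+ (a≡ 3F) v′l
              ; 4F → ≡-mod-+ (a≡ 4F) v′m })

          restored : ∃[ α ] Agrees (reduced v) (λ k → α *ᶻ row₁ h k) →
                     ∃[ α ] ∃[ β ] Agrees v (λ k → α *ᶻ row₁ h k +ᶻ β *ᶻ row₂ h k)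
          restored (α , agrees) = α , v l , λ k →
            ≡-mod-trans (≡-mod-reflexive (restore w∈L (w≡ 3F) v (π ⟨$⟩ʳ k)))
                        (≡-mod-+ (agrees k) (≡-mod-* {a = v l} ≡-mod-refl (w≡ k)))

    standard₁ : ∀ π → Cover (π ⟨$⟩ʳ 0F) (π ⟨$⟩ʳ 1F) (π ⟨$⟩ʳ 2F) →
                ∀ {w} → L w → (∀ k → w (π ⟨$⟩ʳ k) ≡ row₂ h k [mod D ]) → Standard h
    standard₁ π cover {w} w∈L w≡ with nonzero₂ (π ⟨$⟩ʳ 0F) (π ⟨$⟩ʳ 1F)
    ... | u , u∈L , up , uq = choose (shape cover u′∈L)
      where
      u′ : Fin 5 → ℤ
      u′ = reduce π cover w∈L (w≡ 3F) u
      u′∈L : L u′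
      u′∈L = reduce∈L π cover w∈L (w≡ 3F) u∈L
      u′q : ¬ D ∣ᶻ u′ (π ⟨$⟩ʳ 1F)
      u′q d = uq (∣-resp-≡-mod (≡-mod-sym (reduce-0 π cover w∈L (w≡ 3F) {u} (w≡ 1F))) d)
      ul : u′ (π ⟨$⟩ʳ 3F) ≡ + 0 [mod D ]
      ul = reduce-l π cover w∈L (w≡ 3F) {u}
      um : u′ (π ⟨$⟩ʳ 4F) ≡ + 0 [mod D ]
      um = reduce-m π cover w∈L (w≡ 3F) u∈L
      vanish : ∀ {a} → a ≡ + 0 [mod D ] → D ∣ᶻ a
      vanish a≡0 = ∣-resp-≡-mod a≡0 (divides (+ 0) refl)
      choose : Shape (u′ (π ⟨$⟩ʳ 0F)) (u′ (π ⟨$⟩ʳ 1F)) (u′ (π ⟨$⟩ʳ 2F)) → Standard h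
      choose (0-0-0 _ b _) = contradiction (vanish b) u′q
      choose (h-0-h _ b _)  = contradiction (vanish b) u′q
      choose (h-h-0 a b c)  = assemble π cover u′∈L w∈L (λ { 0F → a ; 1F → b ; 2F → c ; 3F → ul ; 4F → um }) w≡
      choose (0-h-h a b c)  = assemble (transpose 0F 2F ∘ₚ π) (reflect cover) u′∈L w∈L
        (λ { 0F → c ; 1F → b ; 2F → a ; 3F → ul ; 4F → um })
        (λ { 0F → w≡ 2F ; 1F → w≡ 1F ; 2F → w≡ 0F ; 3F → w≡ 3F ; 4F → w≡ 4F })

    standard : ∀ π → Cover (π ⟨$⟩ʳ 0F) (π ⟨$⟩ʳ 1F) (π ⟨$⟩ʳ 2F) → Standard h
    standard π cover with unit π cover
    ... | w , w∈L , wl≡1 = choose (shape cover w∈L)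
      where
      wl : w (π ⟨$⟩ʳ 3F) ≡ + 1 [mod D ]
      wl = ≡-mod-reflexive wl≡1
      wm : w (π ⟨$⟩ʳ 4F) ≡ - + 1 [mod D ]
      wm = mod-intro (subst (D ∣ᶻ_)
        (trans (cong (_+ᶻ w (π ⟨$⟩ʳ 4F)) wl≡1) (ℤ.+-comm (+ 1) (w (π ⟨$⟩ʳ 4F))))
        (outer-sum π cover w∈L))
      choose : Shape (w (π ⟨$⟩ʳ 0F)) (w (π ⟨$⟩ʳ 1F)) (w (π ⟨$⟩ʳ 2F)) → Standard h
      choose (0-0-0 a b c) = ⊥-elim (not-zero-shape π cover w∈L wl (a , b , c))
      choose (h-0-h a b c)  = standard₁ π cover w∈L (λ { 0F → a ; 1F → b ; 2F → c ; 3F → wl ; 4F → wm })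
      choose (0-h-h a b c)  = standard₁ (transpose 0F 1F ∘ₚ π) (rotate (reflect cover)) w∈L
        (λ { 0F → b ; 1F → a ; 2F → c ; 3F → wl ; 4F → wm })
      choose (h-h-0 a b c)  = standard₁ (transpose 1F 2F ∘ₚ π) (reflect (rotate cover)) w∈L
        (λ { 0F → a ; 1F → c ; 2F → b ; 3F → wl ; 4F → wm })

-- Assembling the classification

off⁺ : ∀ {l m j} → j ≢ l → j ≢ m → T (off l m j)
off⁺ {l} {m} {j} j≢l j≢m with j ≟ᶠ l | j ≟ᶠ m
... | yes eq | _      = contradiction eq j≢l
... | no _   | yes eq = contradiction eq j≢m
... | no _   | no _   = _

off⁻ : ∀ {l m j} → T (off l m j) → j ≢ l × j ≢ m
off⁻ {l} {m} {j} p with j ≟ᶠ l | j ≟ᶠ m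
... | no j≢l | no j≢m = j≢l , j≢m

sum-mod : ∀ {n D} {u v : Fin n → ℤ} → (∀ j → u j ≡ v j [mod D ]) → sum u ≡ sum v [mod D ]
sum-mod {zero}  p = ≡-mod-refl
sum-mod {suc n} p = ≡-mod-+ (p zero) (sum-mod (p ∘ suc))

∣-*-+-cancelˡ : ∀ {D} k a b → D ∣ᶻ k *ᶻ (a +ᶻ b) → D ∣ᶻ k *ᶻ a → D ∣ᶻ k *ᶻ b
∣-*-+-cancelˡ {D} k a b p q = ∣m+n∣m⇒∣n {m = k *ᶻ a} (subst (D ∣ᶻ_) (ℤ.*-distribˡ-+ k a b) p) q

∣-*-+-cancelʳ : ∀ {D} k a b → D ∣ᶻ k *ᶻ (a +ᶻ b) → D ∣ᶻ k *ᶻ b → D ∣ᶻ k *ᶻ a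
∣-*-+-cancelʳ {D} k a b p q = ∣m+n∣n⇒∣m {m = k *ᶻ a} (subst (D ∣ᶻ_) (ℤ.*-distribˡ-+ k a b) p) q

swap-to-end : Fin 5 → Fin 5 → Permutation′ 5
swap-to-end l m = transpose 4F (PC.transpose 3F l m) ∘ₚ transpose 3F l

swap-to-end-3 : ∀ l m → l ≢ m → swap-to-end l m ⟨$⟩ʳ 3F ≡ l
swap-to-end-3 = from-yes (all? λ l → all? λ m → ¬? (l ≟ᶠ m) →-dec swap-to-end l m ⟨$⟩ʳ 3F ≟ᶠ l)

swap-to-end-4 : ∀ l m → l ≢ m → swap-to-end l m ⟨$⟩ʳ 4F ≡ m
swap-to-end-4 = from-yes (all? λ l → all? λ m → ¬? (l ≟ᶠ m) →-dec swap-to-end l m ⟨$⟩ʳ 4F ≟ᶠ m)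

dsum : ∀ {N₁ N₂ M n₁ n₂} .{{_ : NonZero N₁}} .{{_ : NonZero N₂}} .{{_ : NonZero M}}
       .{{_ : NonZero n₁}} .{{_ : NonZero n₂}} → lcm N₁ N₂ ≡ M →
       (C : Code M (n₁ + n₂)) (C₁ : Code N₁ n₁) (C₂ : Code N₂ n₂) (π : Permutation′ (n₁ + n₂)) →
       (∀ w → w ∈ Words C ⇔ (∃[ c₁ ] ∃[ c₂ ] c₁ ∈ Words C₁ × c₂ ∈ Words C₂ ×
                              permute π w ≡ map (inflate M) c₁ ++ map (inflate M) c₂)) →
       IsDirectSum C
dsum refl C C₁ C₂ π iff = direct-sum C₁ C₂ (π , iff)

module _ {N : ℕ} .{{_ : NonZero N}} where

  ⟪⟫-sum : ∀ {n} (w : Word N n) → + Vec.sum (map toℕ w) ≡ sum ⟪ w ⟫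
  ⟪⟫-sum []      = refl
  ⟪⟫-sum (c ∷ w) = trans (ℤ.pos-+ (toℕ c) _) (cong (+ toℕ c +ᶻ_) (⟪⟫-sum w))

  inflate-id : ∀ {n} (w : Word N n) → map (inflate N) w ≡ w
  inflate-id w = trans (map-cong (λ c → toℕ-unique (≡-mod-trans (mod-≡ (N / N * toℕ c))
    (≡-mod-reflexive (cong +_ (trans (cong (_* toℕ c) (ℕ.n/n≡1 N)) (ℕ.*-identityˡ (toℕ c))))))) w) (map-id w)

  extend : ∀ {k n} → (Fin n → Maybe (Fin k)) → (Fin k → ℤ) → Fin n → ℤ
  extend s v j = maybe′ v (+ 0) (s j)

  pullback : ∀ {k n} → (Fin n → Maybe (Fin k)) → Code N n → Code N k
  pullback s C = record
    { Words    = λ c → Lift C (extend s ⟪ c ⟫)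
    ; 0-closed = Lift-cong C zero-eq (Lift-0 C)
    ; +-closed = λ {v} {w} p q → Lift-cong C (plus-eq v w) (Lift-+ C p q)
    ; ·-closed = λ a {w} p → Lift-cong C (times-eq a w) (Lift-* C (+ toℕ a) p)
    }
    where
    zero-eq : ∀ j → + 0 ≡ extend s ⟪ 0ᵂ ⟫ j [mod + N ]
    zero-eq j with s j
    ... | just i  = ≡-mod-sym (⟪0ᵂ⟫ i)
    ... | nothing = ≡-mod-refl
    plus-eq : ∀ v w j → extend s ⟪ v ⟫ j +ᶻ extend s ⟪ w ⟫ j ≡ extend s ⟪ v +ᵂ w ⟫ j [mod + N ]
    plus-eq v w j with s j
    ... | just i  = ≡-mod-sym (⟪+ᵂ⟫ v w i)
    ... | nothing = ≡-mod-refl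
    times-eq : ∀ a w j → + toℕ a *ᶻ extend s ⟪ w ⟫ j ≡ extend s ⟪ a ·ᵂ w ⟫ j [mod + N ]
    times-eq a w j with s j
    ... | just i  = ≡-mod-sym (⟪·ᵂ⟫ a w i)
    ... | nothing = ≡-mod-reflexive (ℤ.*-zeroʳ (+ toℕ a))

  cut-closed⇒IsDirectSum : (C : Code N 5) (π : Permutation′ 5) →
                           (∀ {v} → Lift C v → Lift C (cut π v)) → IsDirectSum C
  cut-closed⇒IsDirectSum C π cut∈C =
    dsum {n₁ = 3} {n₂ = 2} (ℕ.∣-antisym (lcm-least ℕ.∣-refl ℕ.∣-refl) (m∣lcm[m,n] N N))
         C (pullback s₁ C) (pullback s₂ C) π (λ w → mk⇔ (split w) (join w))
    where
    t₁ : Fin 5 → Maybe (Fin 3)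
    t₁ k = [ just , (λ _ → nothing) ]′ (splitAt 3 k)
    t₂ : Fin 5 → Maybe (Fin 2)
    t₂ k = [ (λ _ → nothing) , just ]′ (splitAt 3 k)
    s₁ : Fin 5 → Maybe (Fin 3)
    s₁ j = t₁ (π ⟨$⟩ˡ j)
    s₂ : Fin 5 → Maybe (Fin 2)
    s₂ j = t₂ (π ⟨$⟩ˡ j)

    Split : Word N 5 → Set
    Split w = ∃[ c₁ ] ∃[ c₂ ] c₁ ∈ Words (pullback s₁ C) × c₂ ∈ Words (pullback s₂ C) ×
              permute π w ≡ map (inflate N) c₁ ++ map (inflate N) c₂

    split : ∀ w → w ∈ Words C → Split w
    split w w∈C = c₁ , c₂ , Lift-cong C (⟨$⟩ʳ-cover π agree₁) cut∈ ,
      Lift-cong C (⟨$⟩ʳ-cover π agree₂) (Lift-+ C (Lift⁺ C w∈C) (Lift-* C (- + 1) cut∈)) ,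
      sym (cong₂ _++_ (inflate-id c₁) (inflate-id c₂))
      where
      c₁ : Word N 3
      c₁ = tabulate (λ i → lookup w (π ⟨$⟩ʳ (i ↑ˡ 2)))
      c₂ : Word N 2
      c₂ = tabulate (λ i → lookup w (π ⟨$⟩ʳ (3 ↑ʳ i)))
      cut∈ : Lift C (cut π ⟪ w ⟫)
      cut∈ = cut∈C (Lift⁺ C w∈C)
      cancel : ∀ a → a +ᶻ - + 1 *ᶻ a ≡ + 0
      cancel = solve-∀
      agree₁ : ∀ k → cut π ⟪ w ⟫ (π ⟨$⟩ʳ k) ≡ extend s₁ ⟪ c₁ ⟫ (π ⟨$⟩ʳ k) [mod + N ]
      agree₁ k rewrite inverseˡ π {k} with k
      ... | 0F = ≡-mod-refl
      ... | 1F = ≡-mod-refl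
      ... | 2F = ≡-mod-refl
      ... | 3F = ≡-mod-refl
      ... | 4F = ≡-mod-refl
      agree₂ : ∀ k → ⟪ w ⟫ (π ⟨$⟩ʳ k) +ᶻ - + 1 *ᶻ cut π ⟪ w ⟫ (π ⟨$⟩ʳ k) ≡ extend s₂ ⟪ c₂ ⟫ (π ⟨$⟩ʳ k) [mod + N ]
      agree₂ k rewrite inverseˡ π {k} with k
      ... | 0F = ≡-mod-reflexive (cancel (⟪ w ⟫ (π ⟨$⟩ʳ 0F)))
      ... | 1F = ≡-mod-reflexive (cancel (⟪ w ⟫ (π ⟨$⟩ʳ 1F)))
      ... | 2F = ≡-mod-reflexive (cancel (⟪ w ⟫ (π ⟨$⟩ʳ 2F)))
      ... | 3F = ≡-mod-reflexive (ℤ.+-identityʳ _)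
      ... | 4F = ≡-mod-reflexive (ℤ.+-identityʳ _)

    join : ∀ w → Split w → w ∈ Words C
    join w (c₁ , c₂ , c₁∈ , c₂∈ , eq) = Lift⁻ C (Lift-cong C (⟨$⟩ʳ-cover π agree) (Lift-+ C c₁∈ c₂∈))
      where
      w≡ : permute π w ≡ c₁ ++ c₂
      w≡ = trans eq (cong₂ _++_ (inflate-id c₁) (inflate-id c₂))
      merge : ∀ (a : Word N 3) (b : Word N 2) k →
              extend t₁ ⟪ a ⟫ k +ᶻ extend t₂ ⟪ b ⟫ k ≡ ⟪ a ++ b ⟫ k
      merge (_ ∷ _ ∷ _ ∷ []) (_ ∷ _ ∷ []) 0F = ℤ.+-identityʳ _
      merge (_ ∷ _ ∷ _ ∷ []) (_ ∷ _ ∷ []) 1F = ℤ.+-identityʳ _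
      merge (_ ∷ _ ∷ _ ∷ []) (_ ∷ _ ∷ []) 2F = ℤ.+-identityʳ _
      merge (_ ∷ _ ∷ _ ∷ []) (_ ∷ _ ∷ []) 3F = ℤ.+-identityˡ _
      merge (_ ∷ _ ∷ _ ∷ []) (_ ∷ _ ∷ []) 4F = ℤ.+-identityˡ _
      agree : ∀ k → extend s₁ ⟪ c₁ ⟫ (π ⟨$⟩ʳ k) +ᶻ extend s₂ ⟪ c₂ ⟫ (π ⟨$⟩ʳ k) ≡ ⟪ w ⟫ (π ⟨$⟩ʳ k) [mod + N ]
      agree k = ≡-mod-reflexive (begin
        extend s₁ ⟪ c₁ ⟫ (π ⟨$⟩ʳ k) +ᶻ extend s₂ ⟪ c₂ ⟫ (π ⟨$⟩ʳ k)
          ≡⟨ cong (λ i → extend t₁ ⟪ c₁ ⟫ i +ᶻ extend t₂ ⟪ c₂ ⟫ i) (inverseˡ π) ⟩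
        extend t₁ ⟪ c₁ ⟫ k +ᶻ extend t₂ ⟪ c₂ ⟫ k   ≡⟨ merge c₁ c₂ k ⟩
        ⟪ c₁ ++ c₂ ⟫ k                             ≡⟨ cong (λ u → ⟪ u ⟫ k) w≡ ⟨
        ⟪ permute π w ⟫ k                          ≡⟨ cong (λ c → + toℕ c) (lookup∘tabulate (λ i → lookup w (π ⟨$⟩ʳ i)) k) ⟩
        ⟪ w ⟫ (π ⟨$⟩ʳ k)                           ∎)
        where open ≡-Reasoning

  module _ {m : ℕ} (g : Matrix N m 5) where

    private
      C : Code N 5
      C = ⟨ g ⟩
      L : (Fin 5 → ℤ) → Set
      L = Lift C
      D : ℤ
      D = + N

    nonvanishing? : (k : ℤ) (S : Fin 5 → Bool) → Dec (∃[ v ] L v × (∀ j → T (S j) → ¬ D ∣ᶻ k *ᶻ v j))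
    nonvanishing? k S = ∃-Lift? g (λ v → all? λ j → T? (S j) →-dec ¬? (D ∣ᶻ? k *ᶻ v j))
      (λ u≋v p j Sj d → p j Sj (∣-resp-≡-mod (≡-mod-* {a = k} ≡-mod-refl (u≋v j)) d))

    combination-∣ : ∀ {k e l} (h : Matrix N k 5) → e ∣ᶻ D → (∀ r → e ∣ᶻ ⟪ lookup h r ⟫ l) →
                    ∀ {u} → Combination h u → e ∣ᶻ u l
    combination-∣ {l = l} []      e∣D rows p = ∣-trans e∣D (p l)
    combination-∣ {l = l} (r ∷ h) e∣D rows {u} (a , p) =
      ∣m+n∣n⇒∣m {m = u l} (combination-∣ h e∣D (rows ∘ suc) p) (∣m⇒∣-m (∣n⇒∣m*n a (rows zero)))

    common-divisor : ∀ {k} l (f : Fin k → Fin 5 → ℤ) → (∀ r → L (f r)) →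
                     ∃[ v ] L v × v l ∣ᶻ D × (∀ r → v l ∣ᶻ f r l)
    common-divisor {zero}  l f f∈L =
      (λ _ → D) , Lift-cong C (λ j → ≡-mod-sym (∣⇒≡0-mod ∣-refl)) (Lift-0 C) , ∣-refl , λ ()
    common-divisor {suc k} l f f∈L with common-divisor l (f ∘ suc) (f∈L ∘ suc)
    ... | v , v∈L , v∣D , v∣f with bézout (v l) (f zero l)
    ...   | α , β , g∣v , g∣f₀ =
      (λ j → α *ᶻ v j +ᶻ β *ᶻ f zero j) ,
      Lift-+ C (Lift-* C α v∈L) (Lift-* C β (f∈L zero)) , ∣-trans g∣v v∣D ,
      λ { zero → g∣f₀ ; (suc r) → ∣-trans g∣v (v∣f r) }

    generator : ∀ l → ∃[ v ] L v × v l ∣ᶻ D × (∀ {u} → L u → v l ∣ᶻ u l)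
    generator l =
      let v , v∈L , v∣D , v∣g = common-divisor l (λ r → ⟪ lookup g r ⟫) (λ r → Lift⁺ C (row r))
      in v , v∈L , v∣D , λ u∈L → combination-∣ g v∣D v∣g (Lift⇒Combination g u∈L)

    module _ (extended : Extended C) where

      L-sum : ∀ {v} → L v → D ∣ᶻ sum v
      L-sum {v} (lift v∈C) = ∣-resp-≡-mod (≡-mod-sym (sum-mod ⟪⟦ v ⟧⟫))
        (subst (D ∣ᶻ_) (⟪⟫-sum ⟦ v ⟧) (∣ᵤ⇒∣ (extended v∈C)))

      module _ (is-gcd : IsGCD (λ k → k ≡ N ⊎ (∃[ w ] w ∈ Words C × ∃[ i ] k ≡ toℕ (lookup w i))) 1) where

        gcd-one : ∀ e → e ∣ᶻ D → (∀ {v} → L v → ∀ j → e ∣ᶻ v j) → e ∣ᶻ + 1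
        gcd-one e e∣D e∣L = ∣ᵤ⇒∣ (proj₂ is-gcd λ
          { (inj₁ refl) → ∣⇒∣ᵤ e∣D
          ; (inj₂ (w , w∈C , i , refl)) → ∣⇒∣ᵤ (e∣L (Lift⁺ C w∈C) i) })

        annihilator⇒multiple : ∀ k → (∀ {v} → L v → ∀ j → D ∣ᶻ k *ᶻ v j) → D ∣ᶻ k
        annihilator⇒multiple k D∣kL with bézout D k
        ... | α , β , g∣D@(divides e D≡eg) , g∣k = subst (_∣ᶻ k) (sym D≡eg) (∣-trans eg∣g g∣k)
          where
          h : ℤ
          h = α *ᶻ D +ᶻ β *ᶻ k

          h≢0 : NonZeroᶻ h
          h≢0 = ≢-nonZero λ h≡0 → ≢-nonZero⁻¹ N
            (ℤ.+-injective (trans D≡eg (trans (cong (e *ᶻ_) h≡0) (ℤ.*-zeroʳ e))))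

          D∣hL : ∀ {v} → L v → ∀ j → D ∣ᶻ v j *ᶻ h
          D∣hL {v} v∈L j = subst (D ∣ᶻ_) (expand α β D k (v j))
            (∣m∣n⇒∣m+n (∣n⇒∣m*n (α *ᶻ v j) (∣-refl {D})) (∣n⇒∣m*n β (D∣kL v∈L j)))
            where
            expand : ∀ α β D k v → (α *ᶻ v) *ᶻ D +ᶻ β *ᶻ (k *ᶻ v) ≡ v *ᶻ (α *ᶻ D +ᶻ β *ᶻ k)
            expand = solve-∀

          e∣1 : e ∣ᶻ + 1
          e∣1 = gcd-one e (divides h (trans D≡eg (ℤ.*-comm e h))) λ {v} v∈L j →
            *-cancelʳ-∣ h {e} {v j} {{h≢0}} (subst (_∣ᶻ v j *ᶻ h) D≡eg (D∣hL v∈L j))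

          eg∣g : e *ᶻ h ∣ᶻ h
          eg∣g = subst (e *ᶻ h ∣ᶻ_) (ℤ.*-identityˡ h) (*-monoˡ-∣ h e∣1)

        annihilated-by-either : ∀ a b → (∀ {x} → L x → (∀ j → D ∣ᶻ a *ᶻ x j) ⊎ (∀ j → D ∣ᶻ b *ᶻ x j)) →
                                   D ∣ᶻ a ⊎ D ∣ᶻ b
        annihilated-by-either a b each = conclude (any? (λ j → nonvanishing? a (λ i → isYes (i ≟ᶠ j))))
          where
          all-a : ¬ (∃[ j ] ∃[ v ] L v × (∀ i → T (isYes (i ≟ᶠ j)) → ¬ D ∣ᶻ a *ᶻ v i)) →
                   ∀ {v} → L v → ∀ j → D ∣ᶻ a *ᶻ v j
          all-a none {v} v∈L j = decidable-stable (D ∣ᶻ? a *ᶻ v j) λ d →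
            none (j , v , v∈L , λ i i≡j → subst (λ i → ¬ D ∣ᶻ a *ᶻ v i) (sym (toWitness i≡j)) d)

          module _ {j v} (v∈L : L v) (avj : ¬ D ∣ᶻ a *ᶻ v j) where

            bv : ∀ i → D ∣ᶻ b *ᶻ v i
            bv = [ (λ av → contradiction (av j) avj) , (λ bv → bv) ]′ (each v∈L)

            all-b : ∀ {x} → L x → ∀ i → D ∣ᶻ b *ᶻ x i
            all-b {x} x∈L = [ shifted (each (Lift-+ C x∈L v∈L)) , (λ bx → bx) ]′ (each x∈L)
              where
              shifted : (∀ i → D ∣ᶻ a *ᶻ (x i +ᶻ v i)) ⊎ (∀ i → D ∣ᶻ b *ᶻ (x i +ᶻ v i)) →
                        (∀ i → D ∣ᶻ a *ᶻ x i) → ∀ i → D ∣ᶻ b *ᶻ x i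
              shifted (inj₁ d) ax = contradiction (∣-*-+-cancelˡ a (x j) (v j) (d j) (ax j)) avj
              shifted (inj₂ d) ax = λ i → ∣-*-+-cancelʳ b (x i) (v i) (d i) (bv i)

          conclude : Dec (∃[ j ] ∃[ v ] L v × (∀ i → T (isYes (i ≟ᶠ j)) → ¬ D ∣ᶻ a *ᶻ v i)) →
                     D ∣ᶻ a ⊎ D ∣ᶻ b
          conclude (no none) = inj₁ (annihilator⇒multiple a (all-a none))
          conclude (yes (j , v , v∈L , av)) =
            inj₂ (annihilator⇒multiple b (all-b {j} {v} v∈L (av j (fromWitness refl))))

        module _ (9≤N : 9 ≤ N) (nondegenerate : ¬ Degenerate C) (¬direct-sum : ¬ IsDirectSum C) where

          nonzero : ∀ i → ∃[ v ] L v × ¬ D ∣ᶻ v i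
          nonzero i = decidable-stable (∃-Lift? g (λ v → ¬? (D ∣ᶻ? v i)) (λ u≋v p d → p (∣-resp-≡-mod (u≋v i) d)))
            λ none → nondegenerate (i , λ {w} w∈C → ∣⇒≡0ₘ
              (decidable-stable (D ∣ᶻ? ⟪ w ⟫ i) λ d → none (⟪ w ⟫ , Lift⁺ C w∈C , d)))

          open Exponent D {L} (Lift-+ C) (Lift-* C) L-sum
          open ThreeCover {D} {L} (Lift-cong C) (Lift-+ C) (Lift-* C) L-sum gcd-one nonzero generator
            (λ π closed → ¬direct-sum (cut-closed⇒IsDirectSum C π closed))

          no-irredundant-cover : ∀ {S} → Certified S → Covers S → ¬ Spread S
          no-irredundant-cover check covers spread =
            [ too-small (ℕ.≤-refl {9}) , too-small (ℕ.m≤m+n 7 2) ]′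
              (annihilated-by-either (+ 8) (+ 6) (exponent-8-or-6 check covers spread))
            where
            too-small : ∀ {k} .{{_ : NonZero k}} → suc k ≤ 9 → ¬ D ∣ᶻ + k
            too-small k<9 N∣k = ℕ.<⇒≱ (ℕ.≤-trans (s≤s (ℕ.∣⇒≤ (∣⇒∣ᵤ N∣k))) k<9) 9≤N

          Nonvanishing : (Fin 5 → Bool) → Set
          Nonvanishing S = ∃[ v ] L v × (∀ j → T (S j) → ¬ D ∣ᶻ + 1 *ᶻ v j)

          ¬nonvanishing⇒covers : ∀ {S} → ¬ Nonvanishing S → Covers S
          ¬nonvanishing⇒covers {S} none {v} v∈L = decidable-stable (any? (λ j → T? (S j) ×-dec D ∣ᶻ? v j))
            λ ¬found → none (v , v∈L , λ j Sj d → ¬found (j , Sj , subst (D ∣ᶻ_) (ℤ.*-identityˡ (v j)) d))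

          opaque
            thin⇒three-cover : (∀ {v} → L v → ∃[ j ] D ∣ᶻ v j) → ∃[ l ] ∃[ m ] l ≢ m × Covers (off l m)
            thin⇒three-cover thin =
              conclude (any? (λ l → any? λ m → ¬? (l ≟ᶠ m) ×-dec ¬? (nonvanishing? (+ 1) (off l m))))
                       (any? (λ l → ¬? (nonvanishing? (+ 1) (off l l))))
              where
              conclude : Dec (∃[ l ] ∃[ m ] l ≢ m × ¬ Nonvanishing (off l m)) →
                         Dec (∃[ l ] ¬ Nonvanishing (off l l)) →
                         ∃[ l ] ∃[ m ] l ≢ m × Covers (off l m)
              conclude (yes (l , m , l≢m , none)) _ = l , m , l≢m , ¬nonvanishing⇒covers none
              conclude (no ¬three) (yes (l , none)) =
                ⊥-elim (no-irredundant-cover (certified-four l) (¬nonvanishing⇒covers none) spread)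
                where
                spread : Spread (off l l)
                spread i i∈ =
                  let l≢i = proj₁ (off⁻ i∈) ∘ sym
                      y , y∈L , y≢0 =
                        decidable-stable (nonvanishing? (+ 1) (off l i)) λ none → ¬three (l , i , l≢i , none)
                  in y , y∈L , λ j j∈ j≢i d → y≢0 j (off⁺ (proj₁ (off⁻ j∈)) j≢i) (∣n⇒∣m*n (+ 1) d)
              conclude (no _) (no ¬four) =
                ⊥-elim (no-irredundant-cover certified-five (λ v∈L → let (j , d) = thin v∈L in j , _ , d) spread)
                where
                spread : Spread (λ _ → true)
                spread i _ =
                  let y , y∈L , y≢0 = decidable-stable (nonvanishing? (+ 1) (off i i)) λ none → ¬four (i , none)
                  in y , y∈L , λ j _ j≢i d → y≢0 j (off⁺ j≢i j≢i) (∣n⇒∣m*n (+ 1) d)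

            three-cover⇒standard : ∀ {l m} → l ≢ m → Covers (off l m) → ∃[ h ] D ≡ + 2 *ᶻ h × Standard h
            three-cover⇒standard {l} {m} l≢m covers = conclude (half cover)
              where
              π : Permutation′ 5
              π = swap-to-end l m
              cover : Cover (π ⟨$⟩ʳ 0F) (π ⟨$⟩ʳ 1F) (π ⟨$⟩ʳ 2F)
              cover {v} v∈L =
                let j , j∈ , D∣vj = covers v∈L in
                ⟨$⟩ʳ-cover π {λ j → T (off l m j) → D ∣ᶻ v j →
                                D ∣ᶻ v (π ⟨$⟩ʳ 0F) ⊎ D ∣ᶻ v (π ⟨$⟩ʳ 1F) ⊎ D ∣ᶻ v (π ⟨$⟩ʳ 2F)} (λ
                { 0F _ d → inj₁ d
                ; 1F _ d → inj₂ (inj₁ d)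
                ; 2F _ d → inj₂ (inj₂ d)
                ; 3F k _ → contradiction (swap-to-end-3 l m l≢m) (proj₁ (off⁻ k))
                ; 4F k _ → contradiction (swap-to-end-4 l m l≢m) (proj₂ (off⁻ k)) }) j j∈ D∣vj
              conclude : (∃[ h ] D ≡ + 2 *ᶻ h × ¬ D ∣ᶻ h) → ∃[ h ] D ≡ + 2 *ᶻ h × Standard h
              conclude (h , D≡2h , D∤h) = h , D≡2h , standard D≡2h D∤h π cover

  module _ (C : Code N 5) {h : ℤ} (N≡2h : + N ≡ + 2 *ᶻ h) where

    2∣N : 2 ∣ N
    2∣N = ∣⇒∣ᵤ (divides h (trans N≡2h (ℤ.*-comm (+ 2) h)))

    h≡N/2 : h ≡ + (N / 2)
    h≡N/2 = ℤ.*-cancelˡ-≡ (+ 2) h (+ (N / 2)) (begin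
      + 2 *ᶻ h             ≡⟨ N≡2h ⟨
      + N                  ≡⟨ cong +_ (ℕ.m/n*n≡m 2∣N) ⟨
      + (N / 2 * 2)       ≡⟨ cong +_ (ℕ.*-comm (N / 2) 2) ⟩
      + (2 * (N / 2))     ≡⟨ ℤ.pos-* 2 (N / 2) ⟩
      + 2 *ᶻ + (N / 2)     ∎)
      where open ≡-Reasoning

    entry-h : + toℕ ((N / 2) mod N) ≡ h [mod + N ]
    entry-h = ≡-mod-trans (mod-≡ (N / 2)) (≡-mod-reflexive (sym h≡N/2))

    entry-−1 : + toℕ ((N ∸ 1) mod N) ≡ - + 1 [mod + N ]
    entry-−1 = ≡-mod-trans (mod-≡ (N ∸ 1)) (mod-intro (divides (+ 1) (begin
      + (N ∸ 1) +ᶻ + 1    ≡⟨ ℤ.pos-+ (N ∸ 1) 1 ⟨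
      + (N ∸ 1 + 1)      ≡⟨ cong +_ (ℕ.m∸n+n≡m (>-nonZero⁻¹ N)) ⟩
      + N                 ≡⟨ ℤ.*-identityˡ (+ N) ⟨
      + 1 *ᶻ + N          ∎)))
      where open ≡-Reasoning

    thin-row₁ : ⟪ lookup (thinMatrix N) 0F ⟫ ≋ row₁ h
    thin-row₁ 0F = entry-h
    thin-row₁ 1F = entry-h
    thin-row₁ 2F = 0ₘ-≡
    thin-row₁ 3F = 0ₘ-≡
    thin-row₁ 4F = 0ₘ-≡

    thin-row₂ : ⟪ lookup (thinMatrix N) 1F ⟫ ≋ row₂ h
    thin-row₂ 0F = entry-h
    thin-row₂ 1F = 0ₘ-≡
    thin-row₂ 2F = entry-h
    thin-row₂ 3F = mod-≡ 1
    thin-row₂ 4F = entry-−1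

    thin-combination : ∀ {v} → Combination (thinMatrix N) v ⇔
                       (∃[ α ] ∃[ β ] v ≋ (λ k → α *ᶻ row₁ h k +ᶻ β *ᶻ row₂ h k))
    thin-combination {v} = mk⇔
      (λ { (α , β , p) → α , β , λ k → ≡-mod-trans (mod-intro (subst (+ N ∣ᶻ_) (regroup (v k) _ _) (p k)))
                                        (rows α β k) })
      (λ { (α , β , p) → α , β , λ k → divisible k (≡-mod-trans (p k) (≡-mod-sym (rows α β k))) })
      where
      rows : ∀ α β k → α *ᶻ ⟪ lookup (thinMatrix N) 0F ⟫ k +ᶻ β *ᶻ ⟪ lookup (thinMatrix N) 1F ⟫ k
                       ≡ α *ᶻ row₁ h k +ᶻ β *ᶻ row₂ h k [mod + N ]
      rows α β k = ≡-mod-+ (≡-mod-* {a = α} ≡-mod-refl (thin-row₁ k)) (≡-mod-* {a = β} ≡-mod-refl (thin-row₂ k))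
      regroup : ∀ a b c → (a -ᶻ b) -ᶻ c ≡ a -ᶻ (b +ᶻ c)
      regroup = solve-∀
      divisible : ∀ k {b c} → v k ≡ b +ᶻ c [mod + N ] → + N ∣ᶻ (v k -ᶻ b) -ᶻ c
      divisible k {b} {c} (mod-intro d) = subst (+ N ∣ᶻ_) (sym (regroup (v k) b c)) d

    standard⇒≅thin : (Σ[ π ∈ Permutation′ 5 ]
        Lift C (row₁ h ∘ (π ⟨$⟩ˡ_)) × Lift C (row₂ h ∘ (π ⟨$⟩ˡ_)) ×
        (∀ {v} → Lift C v → ∃[ α ] ∃[ β ] (∀ k → v (π ⟨$⟩ʳ k) ≡ α *ᶻ row₁ h k +ᶻ β *ᶻ row₂ h k [mod + N ]))) →
      C ≅ ⟨ thinMatrix N ⟩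
    standard⇒≅thin (π , r₁∈C , r₂∈C , expand) = π , λ w → mk⇔ (forward w) (backward w)
      where
      permuted : ∀ w k → ⟪ permute π w ⟫ k ≡ ⟪ w ⟫ (π ⟨$⟩ʳ k)
      permuted w k = cong (λ c → + toℕ c) (lookup∘tabulate (λ i → lookup w (π ⟨$⟩ʳ i)) k)

      forward : ∀ w → w ∈ Words C → Span (thinMatrix N) (permute π w)
      forward w w∈C =
        let α , β , p = expand (Lift⁺ C w∈C)
        in Lift⁻ ⟨ thinMatrix N ⟩ (Combination⇒Lift (thinMatrix N) ⟨ thinMatrix N ⟩ row
             (from thin-combination (α , β , λ k → ≡-mod-trans (≡-mod-reflexive (permuted w k)) (p k))))

      at : ∀ (r : Fin 5 → ℤ) k → r (π ⟨$⟩ˡ (π ⟨$⟩ʳ k)) ≡ r k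
      at r k = cong r (inverseˡ π)

      backward : ∀ w → Span (thinMatrix N) (permute π w) → w ∈ Words C
      backward w s =
        let α , β , p = to thin-combination (Span⇒Combination s)
        in Lift⁻ C (Lift-cong C (⟨$⟩ʳ-cover π λ k → ≡-mod-trans
             (≡-mod-reflexive (cong₂ (λ x y → α *ᶻ x +ᶻ β *ᶻ y) (at (row₁ h) k) (at (row₂ h) k)))
             (≡-mod-trans (≡-mod-sym (p k)) (≡-mod-reflexive (permuted w k))))
             (Lift-+ C (Lift-* C α r₁∈C) (Lift-* C β r₂∈C)))

proposition3p5 : ∀ (N : ℕ) .{{_ : NonZero N}} → 9 ≤ N →
    ∀ (m : ℕ) → (m ≡ 3) ⊎ (m ≡ 4) →
    (g : Matrix N m 5) →
    let C = ⟨ g ⟩ in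
    Admissible C → ¬ Degenerate C → ¬ IsDirectSum C →
    Thin C → (2 ∣ N) × (C ≅ ⟨ thinMatrix N ⟩)
proposition3p5 N 9≤N m _ g (extended , is-gcd) nondegenerate ¬direct-sum thin =
  let l , m , l≢m , covers = thin⇒three-cover g extended is-gcd 9≤N nondegenerate ¬direct-sum zero-entry
      h , N≡2h , std = three-cover⇒standard g extended is-gcd 9≤N nondegenerate ¬direct-sum l≢m covers
  in 2∣N ⟨ g ⟩ N≡2h , standard⇒≅thin ⟨ g ⟩ N≡2h std
  where
  zero-entry : ∀ {v} → Lift ⟨ g ⟩ v → ∃[ j ] + N ∣ᶻ v j
  zero-entry {v} (lift v∈C) = decidable-stable (any? (λ j → + N ∣ᶻ? v j)) λ none →
    thin (⟦ v ⟧ , v∈C , λ j eq → none (j , ∣-resp-≡-mod (≡-mod-sym (⟪⟦ v ⟧⟫ j)) (≡0ₘ⇒∣ eq)))
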